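{- For a partition $\lambda$ of length $\ell$ and $b=(b_1,\dots,b_\ell)\in B(\lambda_1)\otimes\cdots\otimes B(\lambda_\ell)$, $$\mathrm{zmaj}(b)=\mathrm{cocharge}\bigl(\mathfrak c(f_b)_0\bigr),$$ where $f_b$ is the tabloid of shape $\lambda$ whose $i$-th row (from the bottom) is $b_i$, $\mathfrak c$ is the companion map and the subscript $0$ denotes faithful recoloring.
   Context: An element of $B(\lambda_1)\otimes\cdots\otimes B(\lambda_\ell)$ is a tuple $b=(b_1,\dots,b_\ell)$ where $b_i$ is a weakly increasing word of length $\lambda_i$ in positive integers $\le n=|\lambda|$. Rows of shapes are counted upward from the bottom, columns from left to right. A tabloid is a filling whose rows weakly increase from left to right. $\lambda'_c=\#\{r:\lambda_r\ge c\}$. zmaj. $\mathrm{zmaj}(b)=\sum_{w\in Z(b)}\mathrm{maj}(w)$, where $Z(b)$ is the following collection (with multiplicity) of $\lambda_1$ words. The first word $w=w_{\lambda_1'}\cdots w_1$: $w_1$ is the smallest entry of $b_1$; iteratively, $w_i$ is the smallest entry of $b_i$ that is larger than $w_{i-1}$, or, if there is none, the smallest entry of $b_i$. The remaining words are constructed by the same process, ignoring previously selected letters (so the $k$-th word has length $\lambda_k'$, with letters selected from $b_1,\dots,b_{\lambda'_k}$). For a word $w=w_m\cdots w_1$, $\mathrm{maj}(w)=\sum_{j:\,w_{j+1}>w_j}(m-j)$. Colored tabloids. Colored letters $x_y$ are positive integers $x$ (letters) with positive integer subscripts $y$ (colors). Prismatic order: $u_v>r_c$ iff $r<u$, or $r=u$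 and $c>v$. A colored tabloid of weight $\lambda$ and shape $\gamma$ (a composition, zero parts allowed) is a filling of shape $\gamma$ with the colored letters $x_y$, $1\le y\le\lambda_x$, each used once, rows increasing from left to right in prismatic order. The companion $\mathfrak c(F)$ of a filling $F$ of shape $\lambda$ is the colored tabloid obtained by placing, for each cell $(r,c)$ with entry $e$ in $F$, the colored letter $r_c$ in row $e$, and sorting rows increasingly. The circle of a colored tabloid: its entries are placed on a circle clockwise from a marked point $\star$, first row 1 in decreasing prismatic order, then row 2 in decreasing prismatic order, etc. A colored tabloid is faithfully colored when for each $i\ge1$, ignoring entries of color $<i$, the first $1$ clockwise from $\star$ has color $i$ and, for each $x\ge 1$, the first $x+1$ encountered clockwise from $x_i$ (if any) has color $i$. The faithful recoloring $T_0$ of $T$ is the unique faithfully colored tabloid having the same letters in each row as $T$ (colors forgotten) and the same weight. Cocharge. For a colored tabloid $T$ of partition weight $\lambda$ and each color $i$, consider on the circle of $T$ only the entries of color $i$, whose letters are $1,\dots,\lambda'_i$: label letter $1$ with $0$; label letter $a$ with the label of $a-1$ if $\star$ is passed reading clockwise from $a-1$ to $a$, and with that label plus $1$ otherwise. $\mathrm{cocharge}(T)$ is the sum of all labels over all colors $i=1,\dots,\lambda_1$. -}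

module Defs where

open import Data.Bool.Base using (if_then_else_)
open import Data.Fin.Base as Fin using (Fin; toℕ)
import Data.Fin.Properties as Fin
open import Data.List.Base as List
  using (List; []; _∷_; _++_; concat; filter; foldr; head; length; map; reverse; takeWhile; upTo)
import Data.List.Extrema
open import Data.List.Relation.Binary.Permutation.Propositional using (_↭_)
open import Data.List.Relation.Unary.All as All using (All; []; _∷_)
open import Data.List.Relation.Unary.Linked using (Linked)
import Data.List.Relation.Unary.Sorted.TotalOrder as SortedList
import Data.List.Sort.InsertionSort
open import Data.Maybe.Base using (Maybe)
import Data.Maybe.Relation.Unary.All as Maybe
open import Data.Nat.Base using (ℕ; zero; suc; _+_; _≤_; _<_; _≥_)
open import Data.Nat.ListAction using (sum)
open import Data.Nat.Properties using (_≟_; _≤?_; _<?_; <-strictTotalOrder)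
open import Data.Product.Base using (_×_; _,_; proj₁; proj₂)
open import Data.Product.Relation.Binary.Lex.Strict using (×-strictTotalOrder)
open import Data.Vec.Base as Vec using (Vec)
open import Function.Base using (_∘_)
open import Relation.Binary.Bundles using (DecTotalOrder; StrictTotalOrder)
import Relation.Binary.Construct.Flip.EqAndOrd as Flip
import Relation.Binary.Properties.StrictTotalOrder as StrictTotalOrderProperties
open import Relation.Binary.PropositionalEquality using (_≡_)
open import Relation.Nullary.Decidable using (does; ¬?)

------------------------------------------------------------------------
-- Partitions and tensor products of rows

record Partition : Set where
  field
    parts      : List ℕ
    decreasing : Linked _≥_ parts
    positive   : All (0 <_) parts

  size : ℕ
  size = sum parts

  -- λ₁, read as 0 for the empty partition
  largest : ℕ
  largest = foldr (λ k _ → k) 0 parts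

open Partition public

-- The element e of Fin n stands for the positive integer 1 + toℕ e.
record B (n k : ℕ) : Set where
  field
    word       : Vec (Fin n) k
    increasing : Linked Fin._≤_ (Vec.toList word)

open B public

B⊗ : Partition → Set
B⊗ μ = All (B (size μ)) (parts μ)

-- Fillings of the shape with the given row lengths, bottom row first.
Filling : ℕ → List ℕ → Set
Filling n = All (Vec (Fin n))

tabloid : ∀ {n ks} → All (B n) ks → Filling n ks
tabloid = All.map word

rowLists : ∀ {n ks} → Filling n ks → List (List (Fin n))
rowLists []           = []
rowLists (row ∷ rows) = Vec.toList row ∷ rowLists rows

------------------------------------------------------------------------
-- zmaj
--
-- A word w_m ⋯ w₁ is stored as the list w₁ ∷ ⋯ ∷ w_m ∷ [].

module _ {n : ℕ} where

  open Data.List.Extrema (Fin.≤-totalOrder n) using (min)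

  -- smallest y ys and next w y ys select a letter of the row y ∷ ys.
  smallest : Fin n → List (Fin n) → Fin n
  smallest = min

  next : Fin n → Fin n → List (Fin n) → Fin n
  next w y ys with filter (w Fin.<?_) (y ∷ ys)
  ... | []     = smallest y ys
  ... | z ∷ zs = smallest z zs

  remove : Fin n → List (Fin n) → List (Fin n)
  remove v []       = []
  remove v (y ∷ ys) = if does (v Fin.≟ y) then ys else y ∷ remove v ys

  -- The first component is the selected word, the second what is left of
  -- the rows.  The row lengths decrease weakly, and each selection takes
  -- one letter from every nonempty row, so in the k-th selection the rows
  -- before the first empty one are exactly the rows 1, …, λ′_k.
  selectAfter : Fin n → List (List (Fin n)) → List (Fin n) × List (List (Fin n))
  selectAfter w []               = [] , []
  selectAfter w ([] ∷ rows)      = [] , [] ∷ rows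
  selectAfter w ((y ∷ ys) ∷ rows) =
    let v           = next w y ys
        ws , rows′  = selectAfter v rows
    in  v ∷ ws , remove v (y ∷ ys) ∷ rows′

  select : List (List (Fin n)) → List (Fin n) × List (List (Fin n))
  select []                = [] , []
  select ([] ∷ rows)       = [] , [] ∷ rows
  select ((y ∷ ys) ∷ rows) =
    let v          = smallest y ys
        ws , rows′ = selectAfter v rows
    in  v ∷ ws , remove v (y ∷ ys) ∷ rows′

  selections : ℕ → List (List (Fin n)) → List (List (Fin n))
  selections zero    rows = []
  selections (suc k) rows = proj₁ (select rows) ∷ selections k (proj₂ (select rows))

  -- An ascent w_{j+1} > w_j contributes m - j, the number of letters
  -- w_{j+1}, …, w_m.
  maj : List (Fin n) → ℕ
  maj []           = 0
  maj (_ ∷ [])     = 0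
  maj (v ∷ w ∷ ws) =
    (if does (v Fin.<? w) then length (w ∷ ws) else 0) + maj (w ∷ ws)

Z : (μ : Partition) → B⊗ μ → List (List (Fin (size μ)))
Z μ b = selections (largest μ) (rowLists (tabloid b))

zmaj : (μ : Partition) → B⊗ μ → ℕ
zmaj μ b = sum (map maj (Z μ b))

------------------------------------------------------------------------
-- Coloured letters

-- x , y is the letter x with colour y, both counted from 1.
ColouredLetter : Set
ColouredLetter = ℕ × ℕ

letter colour : ColouredLetter → ℕ
letter = proj₁
colour = proj₂

-- (r , c) is below (u , v) when r < u, or r ≡ u and v < c.
prismaticStrictOrder : StrictTotalOrder _ _ _
prismaticStrictOrder =
  ×-strictTotalOrder <-strictTotalOrder (Flip.strictTotalOrder <-strictTotalOrder)

prismaticOrder : DecTotalOrder _ _ _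
prismaticOrder = StrictTotalOrderProperties.decTotalOrder prismaticStrictOrder

open Data.List.Sort.InsertionSort prismaticOrder using (sort)
open SortedList (DecTotalOrder.totalOrder prismaticOrder) using (Sorted)

-- The coloured letters x_y with y ≤ λ_x, each listed once, for x counted
-- from the given start.
colouredLettersFrom : ℕ → List ℕ → List ColouredLetter
colouredLettersFrom x []       = []
colouredLettersFrom x (k ∷ ks) =
  List.tabulate {n = k} (λ y → x , suc (toℕ y)) ++ colouredLettersFrom (suc x) ks

colouredLetters : Partition → List ColouredLetter
colouredLetters μ = colouredLettersFrom 1 (parts μ)

------------------------------------------------------------------------
-- Coloured tabloids

-- n rows, possibly empty, from row 1 upwards.
ColouredFilling : ℕ → Set
ColouredFilling n = Vec (List ColouredLetter) n

-- Since no coloured letter is repeated, Sorted rows increase strictly.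
record IsColouredTabloid (μ : Partition) {n} (T : ColouredFilling n) : Set where
  field
    increasing : ∀ e → Sorted (Vec.lookup T e)
    weight     : concat (Vec.toList T) ↭ colouredLetters μ

cellsFrom : ∀ {n ks} → ℕ → Filling n ks → List (ColouredLetter × Fin n)
cellsFrom r []           = []
cellsFrom r (row ∷ rows) =
  List.tabulate (λ c → (r , suc (toℕ c)) , Vec.lookup row c) ++ cellsFrom (suc r) rows

companion : ∀ {n ks} → Filling n ks → ColouredFilling n
companion F = Vec.tabulate λ e →
  sort (map proj₁ (filter (λ cell → proj₂ cell Fin.≟ e) (cellsFrom 1 F)))

-- The circle, cut open at ⋆ and read clockwise.
circle : ∀ {n} → ColouredFilling n → List ColouredLetter
circle T = concat (map reverse (Vec.toList T))

------------------------------------------------------------------------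
-- Faithful colourings

first : ℕ → List ColouredLetter → Maybe ColouredLetter
first x = head ∘ filter (λ a → letter a ≟ x)

-- On a circle reading xs ++ a ∷ ys from ⋆, the entries met clockwise from
-- a are ys and then, past ⋆, xs.
IsFaithful : ∀ {n} → ColouredFilling n → Set
IsFaithful T = ∀ i → 1 ≤ i →
  let circleᵢ = filter (λ a → i ≤? colour a) (circle T) in
  Maybe.All (λ a → colour a ≡ i) (first 1 circleᵢ) ×
  (∀ x → 1 ≤ x → ∀ xs ys → circleᵢ ≡ xs ++ (x , i) ∷ ys →
    Maybe.All (λ a → colour a ≡ i) (first (suc x) (ys ++ xs)))

letters : ∀ {n} → ColouredFilling n → Vec (List ℕ) n
letters = Vec.map (map letter)

-- Rows are sorted by letter first, so having the same letters in each row
-- is equality of the fillings obtained by forgetting colours.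
record IsFaithfulRecolouring (μ : Partition) {n} (T T₀ : ColouredFilling n) : Set where
  field
    isColouredTabloid : IsColouredTabloid μ T₀
    faithful          : IsFaithful T₀
    sameLetters       : letters T₀ ≡ letters T

------------------------------------------------------------------------
-- Cocharge

lettersOfColour : ∀ {n} → ℕ → ColouredFilling n → List ℕ
lettersOfColour i T = map letter (filter (λ a → colour a ≟ i) (circle T))

position : ℕ → List ℕ → ℕ
position a = length ∘ takeWhile (λ b → ¬? (b ≟ a))

-- Going clockwise from a - 1 to a passes ⋆ unless a - 1 comes before a in
-- the reading from ⋆.
label : List ℕ → ℕ → ℕ
label w zero          = 0
label w (suc zero)    = 0
label w (suc (suc a)) =
  if does (position (suc a) w <? position (suc (suc a)) w)
  then suc (label w (suc a))
  else label w (suc a)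

cocharge : ∀ {n} → Partition → ColouredFilling n → ℕ
cocharge μ T = sum (map colourCocharge (upTo (largest μ)))
  where
  colourCocharge : ℕ → ℕ
  colourCocharge j = let w = lettersOfColour (suc j) T in sum (map (label w) w)

{-# OPTIONS --safe #-}
module Submission where

-- A coloured tabloid of weight μ is the companion of the filling F of shape μ
-- whose entry in row x and column i is the row of the coloured letter x_i.
-- Within a row of the tabloid the circle lists larger letters first, and equal
-- letters by increasing colour.  So, among the letters x + 1, the first one met
-- clockwise from an entry x in row w of the tabloid lies in the lowest row above
-- w, or in the lowest row of all if there is none above w.  This is the rule
-- that selects the words of Z, and faithfulness says that column i of F is the
-- i-th selected word.  Hence a faithful recolouring exists and is unique, and
-- ⋆ is not passed from x_i to (x + 1)_i exactly at the ascents of that word;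
-- an ascent raises the labels of all later letters, which is its share of maj.

open import Defs
open import Data.Bool.Base using (Bool; true; false; if_then_else_)
open import Data.Fin.Base as Fin using (Fin; zero; suc; toℕ)
import Data.Fin.Properties as Fin
open import Data.List.Base as List
  using (List; []; _∷_; _++_; concat; drop; filter; foldr; length; map; reverse)
import Data.List.Extrema
open import Data.List.Membership.Propositional using (_∈_)
open import Data.List.Membership.Propositional.Properties
import Data.List.Properties as List
open import Data.List.Relation.Binary.Permutation.Propositional
  using (_↭_; prep; swap; ↭-refl; ↭-reflexive; ↭-sym; ↭-trans; ↭⇒↭ₛ; module PermutationReasoning)
open import Data.List.Relation.Binary.Permutation.Propositional.Properties as Perm
  using (map⁺; ++⁺; ++⁺ˡ; ↭-reverse; filter-↭; drop-∷; ∈-resp-↭; ↭-map-inv)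
import Data.List.Relation.Binary.Permutation.Setoid.Properties as PermSetoid
open import Data.List.Relation.Binary.Pointwise as Pointwise using (Pointwise; []; _∷_)
open import Data.List.Relation.Unary.All as All using (All; []; _∷_)
import Data.List.Relation.Unary.All.Properties as All
open import Data.List.Relation.Unary.AllPairs as AllPairs using (AllPairs; []; _∷_)
import Data.List.Relation.Unary.AllPairs.Properties as AllPairs
open import Data.List.Relation.Unary.Any using (here; there)
import Data.List.Relation.Unary.Linked.Properties as Linked
import Data.List.Relation.Unary.Sorted.TotalOrder as SortedList
open import Data.List.Relation.Unary.Unique.Propositional using (Unique)
import Data.List.Relation.Unary.Unique.Propositional.Properties as Unique
open import Data.List.Sort.Base using (module SortingAlgorithm)
import Data.List.Sort.InsertionSort
open import Data.Maybe.Base using (Maybe)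
import Data.Maybe.Relation.Unary.All as Maybe
open import Data.Nat.Base using (ℕ; zero; suc; _+_; _*_; _≤_; _<_; z≤n; s≤s; z<s)
open import Data.Nat.ListAction using (sum)
open import Data.Nat.ListAction.Properties using (sum-↭)
import Data.Nat.Properties as ℕ
open import Data.Nat.Tactic.RingSolver using (solve-∀)
open import Data.Product using (Σ; ∃!; ∃-syntax; _×_; _,_; proj₁; proj₂)
open import Data.Sum.Base using (_⊎_; inj₁; inj₂)
open import Data.Vec.Base as Vec using (Vec; []; _∷_)
import Data.Vec.Properties as Vec
open import Function.Base using (_∘_; flip; id)
open import Function.Bundles using (mk⇔)
open import Relation.Binary.Bundles using (DecTotalOrder; StrictTotalOrder)
open import Relation.Binary.PropositionalEquality
open import Relation.Nullary using (¬_; yes; no; does)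
open import Relation.Nullary.Decidable using (dec-true; dec-false; does-⇔)
open import Relation.Nullary.Negation using (contradiction)
open import Relation.Unary using (Decidable)

open Data.List.Sort.InsertionSort prismaticOrder using (sort; insertionSort)
open SortingAlgorithm insertionSort using (sort-↭; sort-↗)
open SortedList (DecTotalOrder.totalOrder prismaticOrder) using (Sorted)
open DecTotalOrder prismaticOrder using () renaming (_≤_ to _≼_; trans to ≼-trans)
open StrictTotalOrder prismaticStrictOrder using () renaming (_<_ to _≺_)

-- Recolouring a companion permutes the entries inside each row of its filling. Tabloids with the
-- same letters thus correspond to tables with the same rows up to permutation, and all comparisons
-- are made modulo `Pointwise _↭_`. The rule for the next letter has two cases, but both ask for the
-- minimum of `rank`, an injective function on rows. The chosen entry is therefore determined by the
-- row as a multiset, and this one principle yields existence, uniqueness and agreement with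
-- `select`. Ignoring the colours up to i amounts to dropping i columns, so a table is treated by
-- splitting off its first column and recursing on `tails`. Within a column the recursion runs over
-- the rows; between columns the remaining rows are known only up to permutation. Weakly decreasing
-- row lengths make every column end at its first gap, so a word that stops at an empty row has met
-- all entries of its colour.

private variable
  A A′ : Set
  n : ℕ

-- Sorted permutations, maps and fibres of lists

AllPairs-↭⇒≡ : {R : A → A → Set} → (∀ {x y} → R x y → R y x → x ≡ y) →
  ∀ {xs ys} → AllPairs R xs → AllPairs R ys → xs ↭ ys → xs ≡ ys
AllPairs-↭⇒≡ anti {[]} {ys} _ _ p = sym (Perm.↭-empty-inv (↭-sym p))
AllPairs-↭⇒≡ anti {x ∷ xs} {[]} _ _ p = contradiction p Perm.¬x∷xs↭[]
AllPairs-↭⇒≡ {R = R} anti {x ∷ xs} {y ∷ ys} (Rx ∷ Rxs) (Ry ∷ Rys) p =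
  cons (same (∈-resp-↭ p (here refl)) (∈-resp-↭ (↭-sym p) (here refl)))
  where
  same : x ∈ y ∷ ys → y ∈ x ∷ xs → x ≡ y
  same (here eq)  _          = eq
  same (there _)  (here eq)  = sym eq
  same (there x∈) (there y∈) = anti (All.lookup Rx y∈) (All.lookup Ry x∈)

  cons : x ≡ y → x ∷ xs ≡ y ∷ ys
  cons refl = cong (x ∷_) (AllPairs-↭⇒≡ anti Rxs Rys (drop-∷ p))

AllPairs-reverse : {R : A → A → Set} → ∀ {xs} → AllPairs R xs → AllPairs (flip R) (reverse xs)
AllPairs-reverse [] = []
AllPairs-reverse {R = R} {x ∷ xs} (Rx ∷ Rxs) =
  subst (AllPairs (flip R)) (sym (List.unfold-reverse x xs))
    (AllPairs.++⁺ (AllPairs-reverse Rxs) ([] ∷ [])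
      (All.map (_∷ []) (Perm.All-resp-↭ (↭-sym (↭-reverse xs)) Rx)))

Unique-resp-↭ : {xs ys : List A} → xs ↭ ys → Unique xs → Unique ys
Unique-resp-↭ {A = A} p = PermSetoid.Unique-resp-↭ (setoid A) (↭⇒↭ₛ p)

Unique-map⇒injective : (f : A → A′) → ∀ {xs} → Unique (map f xs) →
  ∀ {x y} → x ∈ xs → y ∈ xs → f x ≡ f y → x ≡ y
Unique-map⇒injective f u x∈ y∈ eq with ∈-AllPairs₂ (AllPairs.map⁻ u) x∈ y∈
... | inj₁ x≡y          = x≡y
... | inj₂ (inj₁ fx≢fy) = contradiction eq fx≢fy
... | inj₂ (inj₂ fy≢fx) = contradiction (sym eq) fy≢fx

AllPairs-++⁻ : ∀ {R : A → A → Set} Xs {c Ys} → AllPairs R (Xs ++ c ∷ Ys) →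
  AllPairs R Xs × AllPairs R Ys × All (λ p → R p c) Xs × All (R c) Ys
AllPairs-++⁻ [] (c ∷ r) = [] , r , [] , c
AllPairs-++⁻ (x ∷ Xs) (px ∷ r) with sX , sY , l , h ← AllPairs-++⁻ Xs r
  with pXs , pc ∷ _ ← All.++⁻ Xs px = pXs ∷ sX , sY , pc ∷ l , h

map≡++⇒ : (f : A → A′) → ∀ zs xs {ys} → map f zs ≡ xs ++ ys →
  ∃[ us ] ∃[ vs ] zs ≡ us ++ vs × map f us ≡ xs × map f vs ≡ ys
map≡++⇒ f zs [] eq = [] , zs , refl , refl , eq
map≡++⇒ f (z ∷ zs) (x ∷ xs) eq
  with us , vs , refl , refl , refl ← map≡++⇒ f zs xs (List.∷-injectiveʳ eq)
  = z ∷ us , vs , refl , cong (_∷ map f us) (List.∷-injectiveˡ eq) , refl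

filter-map : {P : A′ → Set} (P? : Decidable P) (f : A → A′) → ∀ xs →
  filter P? (map f xs) ≡ map f (filter (P? ∘ f) xs)
filter-map P? f [] = refl
filter-map P? f (x ∷ xs) with does (P? (f x))
... | true  = cong (f x ∷_) (filter-map P? f xs)
... | false = filter-map P? f xs

concat-tabulate-↭ : ∀ {m} {f g : Fin m → List A} → (∀ e → f e ↭ g e) →
  concat (List.tabulate f) ↭ concat (List.tabulate g)
concat-tabulate-↭ {m = zero}  p = ↭-refl
concat-tabulate-↭ {m = suc m} p = ++⁺ (p zero) (concat-tabulate-↭ (p ∘ suc))

concat-tabulate-insert : ∀ {m} {x : A} {f g : Fin m → List A} (d : Fin m) →
  g d ≡ x ∷ f d → (∀ e → e ≢ d → g e ≡ f e) →
  concat (List.tabulate g) ↭ x ∷ concat (List.tabulate f)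
concat-tabulate-insert {f = f} zero gd ge rewrite gd =
  prep _ (↭-reflexive (cong (λ xss → f zero ++ concat xss) (List.tabulate-cong λ e → ge (suc e) λ ())))
concat-tabulate-insert {x = x} {f} (suc d) gd ge rewrite ge zero (λ ()) =
  ↭-trans (++⁺ˡ (f zero) (concat-tabulate-insert d gd λ e e≢d → ge (suc e) (e≢d ∘ Fin.suc-injective)))
          (Perm.shift x (f zero) _)

module _ (key : A → Fin n) where

  fibre : List A → Fin n → List A
  fibre xs e = filter (λ x → key x Fin.≟ e) xs

  concat-fibres : ∀ xs → concat (List.tabulate (fibre xs)) ↭ xs
  concat-fibres [] = ↭-reflexive (empty n)
    where
    empty : ∀ m → concat (List.tabulate {n = m} λ _ → List.[] {A = A}) ≡ []
    empty zero    = refl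
    empty (suc m) = empty m
  concat-fibres (x ∷ xs) = ↭-trans
    (concat-tabulate-insert (key x) (List.filter-accept (λ y → key y Fin.≟ key x) refl)
      λ e e≢ → List.filter-reject (λ y → key y Fin.≟ e) (e≢ ∘ sym))
    (prep x (concat-fibres xs))

  -- The injection `h` serves the induction: the recursion shrinks the index type `Fin m` of the
  -- pieces, while the keys stay in `Fin n`.
  fibre-concat : ∀ {m} (h : Fin m → Fin n) → (∀ {d e} → h d ≡ h e → d ≡ e) →
    (f : Fin m → List A) → (∀ e → All (λ x → key x ≡ h e) (f e)) →
    ∀ e → fibre (concat (List.tabulate f)) (h e) ≡ f e
  fibre-concat h inj f all zero = begin
    fibre (f zero ++ concat (List.tabulate (f ∘ suc))) (h zero)
      ≡⟨ List.filter-++ _ (f zero) _ ⟩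
    fibre (f zero) (h zero) ++ fibre (concat (List.tabulate (f ∘ suc))) (h zero)
      ≡⟨ cong₂ _++_ (List.filter-all _ (all zero))
           (List.filter-none _ (All.concat⁺ (All.tabulate⁺ λ d →
             All.map (λ eq eq′ → Fin.0≢1+n (inj (trans (sym eq′) eq))) (all (suc d))))) ⟩
    f zero ++ [] ≡⟨ List.++-identityʳ _ ⟩
    f zero ∎
    where open ≡-Reasoning
  fibre-concat h inj f all (suc e) = begin
    fibre (f zero ++ concat (List.tabulate (f ∘ suc))) (h (suc e))
      ≡⟨ List.filter-++ _ (f zero) _ ⟩
    fibre (f zero) (h (suc e)) ++ fibre (concat (List.tabulate (f ∘ suc))) (h (suc e))
      ≡⟨ cong₂ _++_
           (List.filter-none _ (All.map (λ eq eq′ → Fin.0≢1+n (inj (trans (sym eq) eq′))) (all zero)))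
           (fibre-concat (h ∘ suc) (Fin.suc-injective ∘ inj) (f ∘ suc) (all ∘ suc) e) ⟩
    f (suc e) ∎
    where open ≡-Reasoning

toList-tabulate : ∀ {m} (f : Fin m → A) → Vec.toList (Vec.tabulate f) ≡ List.tabulate f
toList-tabulate {m = zero}  f = refl
toList-tabulate {m = suc m} f = cong (f zero ∷_) (toList-tabulate (f ∘ suc))

-- Coloured tabloids as lists of cells

-- (a , e) is the coloured letter a in row e.
Cell : ℕ → Set
Cell n = ColouredLetter × Fin n

rowAt : List (A × Fin n) → Fin n → List A
rowAt C e = map proj₁ (fibre proj₂ C e)

-- By definition `companion F` is `place (cellsFrom 1 F)`. Allowing any list of cells also covers
-- tabloids that are not yet known to be companions.
place : List (Cell n) → ColouredFilling n
place C = Vec.tabulate λ e → sort (rowAt C e)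

-- Rows are plain lists from here on, because splitting off columns changes their lengths.
rowCells : ℕ → ℕ → List (Fin n) → List (Cell n)
rowCells x k []       = []
rowCells x k (e ∷ es) = ((x , k) , e) ∷ rowCells x (suc k) es

cells : ℕ → List (List (Fin n)) → List (Cell n)
cells x []           = []
cells x (row ∷ rows) = rowCells x 1 row ++ cells (suc x) rows

rowCells-toList : ∀ {m} x k (h : Fin m → ℕ) → (∀ c → h c ≡ k + toℕ c) → (row : Vec (Fin n) m) →
  List.tabulate (λ c → (x , h c) , Vec.lookup row c) ≡ rowCells x k (Vec.toList row)
rowCells-toList x k h eq []        = refl
rowCells-toList x k h eq (e ∷ row) = cong₂ _∷_
  (cong (λ c → (x , c) , e) (trans (eq zero) (ℕ.+-identityʳ k)))
  (rowCells-toList x (suc k) (h ∘ suc) (λ c → trans (eq (suc c)) (ℕ.+-suc k (toℕ c))) row)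

cellsFrom≡cells : ∀ {ks} x (F : Filling n ks) → cellsFrom x F ≡ cells x (rowLists F)
cellsFrom≡cells x []           = refl
cellsFrom≡cells x (row ∷ rows) =
  cong₂ _++_ (rowCells-toList x 1 _ (λ _ → refl) row) (cellsFrom≡cells (suc x) rows)

map-proj₁-cellsFrom : ∀ {ks} x (F : Filling n ks) → map proj₁ (cellsFrom x F) ≡ colouredLettersFrom x ks
map-proj₁-cellsFrom x []           = refl
map-proj₁-cellsFrom x (row ∷ rows) = trans (List.map-++ proj₁ _ (cellsFrom (suc x) rows))
  (cong₂ _++_ (List.map-tabulate _ proj₁) (map-proj₁-cellsFrom (suc x) rows))

≤-colouredLettersFrom : ∀ x ks → All (λ a → x ≤ letter a) (colouredLettersFrom x ks)
≤-colouredLettersFrom x []       = []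
≤-colouredLettersFrom x (k ∷ ks) = All.++⁺ (All.tabulate⁺ λ _ → ℕ.≤-refl)
  (All.map ℕ.<⇒≤ (≤-colouredLettersFrom (suc x) ks))

colouredLettersFrom-unique : ∀ x ks → Unique (colouredLettersFrom x ks)
colouredLettersFrom-unique x []       = []
colouredLettersFrom-unique x (k ∷ ks) = Unique.++⁺
  (Unique.tabulate⁺ λ eq → Fin.toℕ-injective (ℕ.suc-injective (cong proj₂ eq)))
  (colouredLettersFrom-unique (suc x) ks)
  λ (a∈ , a∈′) → letter-≮ (∈-tabulate⁻ a∈) (All.lookup (≤-colouredLettersFrom (suc x) ks) a∈′)
  where
  letter-≮ : ∀ {a} → (∃[ y ] a ≡ (x , suc (toℕ {k} y))) → ¬ (suc x ≤ letter a)
  letter-≮ (_ , refl) = ℕ.<-irrefl refl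

sort-AllPairs : ∀ as → AllPairs _≼_ (sort as)
sort-AllPairs as = Linked.Linked⇒AllPairs
  (λ {a} {b} {c} → ≼-trans {a} {b} {c}) (sort-↗ as)

≼-antisym : ∀ {a b} → a ≼ b → b ≼ a → a ≡ b
≼-antisym a≼b b≼a with refl , refl ← DecTotalOrder.antisym prismaticOrder a≼b b≼a = refl

place-↭ : {C D : List (Cell n)} → C ↭ D → place C ≡ place D
place-↭ {C = C} {D} C↭D = Vec.tabulate-cong λ e →
  AllPairs-↭⇒≡ ≼-antisym (sort-AllPairs (rowAt C e)) (sort-AllPairs (rowAt D e))
    (↭-trans (sort-↭ (rowAt C e))
      (↭-trans (map⁺ proj₁ (filter-↭ _ C↭D)) (↭-sym (sort-↭ (rowAt D e)))))

concat-place : (C : List (Cell n)) → concat (Vec.toList (place C)) ↭ map proj₁ C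
concat-place C = begin
  concat (Vec.toList (place C)) ≡⟨ cong concat (toList-tabulate (sort ∘ rowAt C)) ⟩
  concat (List.tabulate (sort ∘ rowAt C))
    ↭⟨ concat-tabulate-↭ (λ e → sort-↭ (rowAt C e)) ⟩
  concat (List.tabulate (rowAt C))
    ≡⟨ cong concat (List.map-tabulate (fibre proj₂ C) (map proj₁)) ⟨
  concat (map (map proj₁) (List.tabulate (fibre proj₂ C))) ≡⟨ List.concat-map (List.tabulate (fibre proj₂ C)) ⟩
  map proj₁ (concat (List.tabulate (fibre proj₂ C))) ↭⟨ map⁺ proj₁ (concat-fibres proj₂ C) ⟩
  map proj₁ C ∎
  where open PermutationReasoning

companion-isColouredTabloid : (μ : Partition) (F : Filling n (parts μ)) →
  IsColouredTabloid μ (companion F)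
companion-isColouredTabloid μ F = record
  { increasing = λ e → subst Sorted (sym (Vec.lookup∘tabulate _ e)) (sort-↗ (rowAt (cellsFrom 1 F) e))
  ; weight     = ↭-trans (concat-place (cellsFrom 1 F)) (↭-reflexive (map-proj₁-cellsFrom 1 F))
  }

-- Every coloured tabloid is a companion

cellsOf : ColouredFilling n → List (Cell n)
cellsOf T = concat (List.tabulate λ e → map (_, e) (Vec.lookup T e))

map-proj₁-tag : (e : A′) (as : List A) → map proj₁ (map (_, e) as) ≡ as
map-proj₁-tag e as = trans (sym (List.map-∘ as)) (List.map-id as)

map-proj₁-cellsOf : (T : ColouredFilling n) → map proj₁ (cellsOf T) ≡ concat (Vec.toList T)
map-proj₁-cellsOf T = begin
  map proj₁ (cellsOf T) ≡⟨ List.concat-map (List.tabulate λ e → map (_, e) (Vec.lookup T e)) ⟨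
  concat (map (map proj₁) (List.tabulate λ e → map (_, e) (Vec.lookup T e)))
    ≡⟨ cong concat (List.map-tabulate (λ e → map (_, e) (Vec.lookup T e)) (map proj₁)) ⟩
  concat (List.tabulate λ e → map proj₁ (map (_, e) (Vec.lookup T e)))
    ≡⟨ cong concat (List.tabulate-cong λ e → map-proj₁-tag e (Vec.lookup T e)) ⟩
  concat (List.tabulate (Vec.lookup T)) ≡⟨ cong concat (toList-tabulate (Vec.lookup T)) ⟨
  concat (Vec.toList (Vec.tabulate (Vec.lookup T))) ≡⟨ cong (concat ∘ Vec.toList) (Vec.tabulate∘lookup T) ⟩
  concat (Vec.toList T) ∎
  where open ≡-Reasoning

place-cellsOf : ∀ {μ} {T : ColouredFilling n} → IsColouredTabloid μ T → place (cellsOf T) ≡ T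
place-cellsOf {T = T} t = trans
  (Vec.tabulate-cong λ e → AllPairs-↭⇒≡ ≼-antisym (sort-AllPairs (rowAt (cellsOf T) e))
    (Linked.Linked⇒AllPairs (λ {a} {b} {c} → ≼-trans {a} {b} {c}) (IsColouredTabloid.increasing t e))
    (↭-trans (sort-↭ (rowAt (cellsOf T) e)) (↭-reflexive (trans
      (cong (map proj₁) (fibre-concat proj₂ id id _ (λ e → All.map⁺ (All.universal (λ _ → refl) _)) e))
      (map-proj₁-tag e (Vec.lookup T e))))))
  (Vec.tabulate∘lookup T)

untabulate : ∀ {k} (g : Fin k → ColouredLetter) (C : List (Cell n)) →
  map proj₁ C ≡ List.tabulate g →
  ∃[ row ] C ≡ List.tabulate (λ c → g c , Vec.lookup row c)
untabulate {k = zero}  g []             eq = [] , refl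
untabulate {k = suc k} g ((a , e) ∷ C) eq with refl , eq′ ← List.∷-injective eq
  with row , refl ← untabulate (g ∘ suc) C eq′ = e ∷ row , refl

uncells : ∀ x ks (C : List (Cell n)) → map proj₁ C ≡ colouredLettersFrom x ks →
  ∃[ F ] C ≡ cellsFrom {ks = ks} x F
uncells x []       []      eq = [] , refl
uncells x (k ∷ ks) C       eq
  with us , vs , refl , eq₁ , eq₂ ← map≡++⇒ proj₁ C (List.tabulate _) eq
  with row , us≡ ← untabulate (λ y → x , suc (toℕ y)) us eq₁ | rows , vs≡ ← uncells (suc x) ks vs eq₂
  = row ∷ rows , cong₂ _++_ us≡ vs≡

-- The weight condition lets the cells of `T` be reordered until their coloured letters come in the
-- standard order. Such a list splits into blocks of equal letter, and the rows recorded in the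
-- block of x form row x of `F`.
colouredTabloid⇒companion : ∀ {μ} {T : ColouredFilling n} → IsColouredTabloid μ T →
  ∃[ F ] T ≡ companion {ks = parts μ} F
colouredTabloid⇒companion {μ = μ} {T} t
  with C , eq , p ← ↭-map-inv proj₁ (↭-trans (↭-reflexive (map-proj₁-cellsOf T)) (IsColouredTabloid.weight t))
  with F , refl ← uncells 1 (parts μ) C (sym eq)
  = F , trans (sym (place-cellsOf t)) (place-↭ p)

-- Forgetting colours, and tables up to permutation of rows

forgetColour : Cell n → ℕ × Fin n
forgetColour ((x , _) , e) = x , e

letters-sort-↭ : (C : List (Cell n)) → ∀ e →
  map letter (sort (rowAt C e)) ↭ rowAt (map forgetColour C) e
letters-sort-↭ C e = begin
  map letter (sort (rowAt C e)) ↭⟨ map⁺ letter (sort-↭ (rowAt C e)) ⟩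
  map letter (map proj₁ (fibre proj₂ C e)) ≡⟨ List.map-∘ (fibre proj₂ C e) ⟨
  map (letter ∘ proj₁) (fibre proj₂ C e) ≡⟨ List.map-∘ (fibre proj₂ C e) ⟩
  map proj₁ (map forgetColour (fibre proj₂ C e)) ≡⟨ cong (map proj₁) (filter-map _ forgetColour C) ⟨
  rowAt (map forgetColour C) e ∎
  where open PermutationReasoning

letters-sort-sorted : ∀ as → AllPairs _≤_ (map letter (sort as))
letters-sort-sorted as = AllPairs.map⁺ (AllPairs.map letter-mono (sort-AllPairs as))
  where
  letter-mono : ∀ {a b} → a ≼ b → letter a ≤ letter b
  letter-mono (inj₁ (inj₁ x<y))       = ℕ.<⇒≤ x<y
  letter-mono (inj₁ (inj₂ (x≡y , _))) = ℕ.≤-reflexive x≡y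
  letter-mono (inj₂ (x≡y , _))        = ℕ.≤-reflexive x≡y

letters-place : (C : List (Cell n)) →
  letters (place C) ≡ Vec.tabulate (λ e → map letter (sort (rowAt C e)))
letters-place C = sym (Vec.tabulate-∘ (map letter) (sort ∘ rowAt C))

-- The prismatic order compares letters first, so a row of `place` stays sorted when colours are
-- forgotten, and a sorted row is determined by its multiset.
↭⇒sameLetters : (C D : List (Cell n)) → map forgetColour C ↭ map forgetColour D →
  letters (place C) ≡ letters (place D)
↭⇒sameLetters C D p = begin
  letters (place C)                                       ≡⟨ letters-place C ⟩
  Vec.tabulate (λ e → map letter (sort (rowAt C e)))      ≡⟨ Vec.tabulate-cong same ⟩
  Vec.tabulate (λ e → map letter (sort (rowAt D e)))      ≡⟨ letters-place D ⟨
  letters (place D)                                       ∎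
  where
  open ≡-Reasoning
  same : ∀ e → map letter (sort (rowAt C e)) ≡ map letter (sort (rowAt D e))
  same e = AllPairs-↭⇒≡ ℕ.≤-antisym (letters-sort-sorted (rowAt C e)) (letters-sort-sorted (rowAt D e))
    (↭-trans (letters-sort-↭ C e)
      (↭-trans (map⁺ proj₁ (filter-↭ _ p)) (↭-sym (letters-sort-↭ D e))))

retag : (L : List (A × Fin n)) → ∀ e → map (_, e) (rowAt L e) ≡ fibre proj₂ L e
retag []            e = refl
retag ((x , d) ∷ L) e with d Fin.≟ e
... | yes refl = cong ((x , d) ∷_) (retag L e)
... | no _     = retag L e

sameLetters⇒↭ : (C D : List (Cell n)) → letters (place C) ≡ letters (place D) →
  map forgetColour C ↭ map forgetColour D
sameLetters⇒↭ C D eq = begin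
  map forgetColour C                                            ↭⟨ concat-fibres proj₂ _ ⟨
  concat (List.tabulate (fibre proj₂ (map forgetColour C)))     ↭⟨ concat-tabulate-↭ same ⟩
  concat (List.tabulate (fibre proj₂ (map forgetColour D)))     ↭⟨ concat-fibres proj₂ _ ⟩
  map forgetColour D                                            ∎
  where
  open PermutationReasoning
  rows≡ : ∀ e → map letter (sort (rowAt C e)) ≡ map letter (sort (rowAt D e))
  rows≡ e = trans (sym (Vec.lookup∘tabulate _ e)) (trans
    (cong (λ v → Vec.lookup v e) (trans (sym (letters-place C)) (trans eq (letters-place D))))
    (Vec.lookup∘tabulate _ e))
  same : ∀ e → fibre proj₂ (map forgetColour C) e ↭ fibre proj₂ (map forgetColour D) e
  same e = begin
    fibre proj₂ (map forgetColour C) e ≡⟨ retag (map forgetColour C) e ⟨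
    map (_, e) (rowAt (map forgetColour C) e) ↭⟨ map⁺ (_, e) (letters-sort-↭ C e) ⟨
    map (_, e) (map letter (sort (rowAt C e))) ≡⟨ cong (map (_, e)) (rows≡ e) ⟩
    map (_, e) (map letter (sort (rowAt D e))) ↭⟨ map⁺ (_, e) (letters-sort-↭ D e) ⟩
    map (_, e) (rowAt (map forgetColour D) e) ≡⟨ retag (map forgetColour D) e ⟩
    fibre proj₂ (map forgetColour D) e ∎

tagRows : ℕ → List (List (Fin n)) → List (ℕ × Fin n)
tagRows x []           = []
tagRows x (row ∷ rows) = map (x ,_) row ++ tagRows (suc x) rows

forgetColour-rowCells : ∀ x k (row : List (Fin n)) → map forgetColour (rowCells x k row) ≡ map (x ,_) row
forgetColour-rowCells x k []        = refl
forgetColour-rowCells x k (e ∷ row) = cong ((x , e) ∷_) (forgetColour-rowCells x (suc k) row)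

forgetColour-cells : ∀ x (rows : List (List (Fin n))) → map forgetColour (cells x rows) ≡ tagRows x rows
forgetColour-cells x []           = refl
forgetColour-cells x (row ∷ rows) = trans (List.map-++ forgetColour (rowCells x 1 row) _)
  (cong₂ _++_ (forgetColour-rowCells x 1 row) (forgetColour-cells (suc x) rows))

tagRows-↭ : ∀ {rows rows′ : List (List (Fin n))} x → Pointwise _↭_ rows rows′ →
  tagRows x rows ↭ tagRows x rows′
tagRows-↭ x []       = ↭-refl
tagRows-↭ x (p ∷ ps) = ++⁺ (map⁺ (x ,_) p) (tagRows-↭ (suc x) ps)

≤-tagRows : ∀ x (rows : List (List (Fin n))) → All (λ t → x ≤ proj₁ t) (tagRows x rows)
≤-tagRows x []           = []
≤-tagRows x (row ∷ rows) = All.++⁺ (All.map⁺ (All.universal (λ _ → ℕ.≤-refl) row))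
  (All.map ℕ.<⇒≤ (≤-tagRows (suc x) rows))

module _ (x : ℕ) (row : List (Fin n)) (rows : List (List (Fin n))) where

  row-tagRows : map proj₂ (filter (λ t → proj₁ t ℕ.≟ x) (tagRows x (row ∷ rows))) ≡ row
  row-tagRows = begin
    map proj₂ (filter _ (map (x ,_) row ++ tagRows (suc x) rows))
      ≡⟨ cong (map proj₂) (List.filter-++ _ (map (x ,_) row) _) ⟩
    map proj₂ (filter _ (map (x ,_) row) ++ filter _ (tagRows (suc x) rows))
      ≡⟨ cong (map proj₂) (cong₂ _++_
           (List.filter-all _ (All.map⁺ (All.universal (λ _ → refl) row)))
           (List.filter-none _ (All.map (λ x<y y≡x → ℕ.<⇒≢ x<y (sym y≡x)) (≤-tagRows (suc x) rows)))) ⟩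
    map proj₂ (map (x ,_) row ++ []) ≡⟨ cong (map proj₂) (List.++-identityʳ _) ⟩
    map proj₂ (map (x ,_) row) ≡⟨ List.map-∘ row ⟨
    map id row ≡⟨ List.map-id row ⟩
    row ∎
    where open ≡-Reasoning

  rows-tagRows : filter (λ t → x ℕ.<? proj₁ t) (tagRows x (row ∷ rows)) ≡ tagRows (suc x) rows
  rows-tagRows = trans (List.filter-++ _ (map (x ,_) row) _) (cong₂ _++_
    (List.filter-none _ (All.map⁺ (All.universal (λ _ → ℕ.<-irrefl refl) row)))
    (List.filter-all _ (≤-tagRows (suc x) rows)))

-- Row x is recovered by filtering on the tag x, which respects permutations. The lengths are
-- compared separately because trailing empty rows leave no trace among the tags.
tagRows-↭⁻ : ∀ x (rows rows′ : List (List (Fin n))) → length rows ≡ length rows′ →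
  tagRows x rows ↭ tagRows x rows′ → Pointwise _↭_ rows rows′
tagRows-↭⁻ x [] [] _ p = []
tagRows-↭⁻ x (row ∷ rows) (row′ ∷ rows′) eq p =
  subst₂ _↭_ (row-tagRows x row rows) (row-tagRows x row′ rows′) (map⁺ proj₂ (filter-↭ _ p)) ∷
  tagRows-↭⁻ (suc x) rows rows′ (ℕ.suc-injective eq)
    (subst₂ _↭_ (rows-tagRows x row rows) (rows-tagRows x row′ rows′) (filter-↭ _ p))

rowLists-length : ∀ {ks} (F : Filling n ks) → map length (rowLists F) ≡ ks
rowLists-length []           = refl
rowLists-length (row ∷ rows) = cong₂ _∷_ (Vec.length-toList row) (rowLists-length rows)

rowLists-lengths : ∀ {ks} (F G : Filling n ks) → length (rowLists F) ≡ length (rowLists G)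
rowLists-lengths []      []      = refl
rowLists-lengths (_ ∷ F) (_ ∷ G) = cong suc (rowLists-lengths F G)

module _ {ks} (F G : Filling n ks) where

  forgetColour-cellsFrom : (H : Filling n ks) → map forgetColour (cellsFrom 1 H) ≡ tagRows 1 (rowLists H)
  forgetColour-cellsFrom H =
    trans (cong (map forgetColour) (cellsFrom≡cells 1 H)) (forgetColour-cells 1 (rowLists H))

  ↭⇒companion-letters : Pointwise _↭_ (rowLists F) (rowLists G) →
    letters (companion F) ≡ letters (companion G)
  ↭⇒companion-letters p = ↭⇒sameLetters (cellsFrom 1 F) (cellsFrom 1 G)
    (subst₂ _↭_ (sym (forgetColour-cellsFrom F)) (sym (forgetColour-cellsFrom G)) (tagRows-↭ 1 p))

  companion-letters⇒↭ : letters (companion F) ≡ letters (companion G) →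
    Pointwise _↭_ (rowLists F) (rowLists G)
  companion-letters⇒↭ eq = tagRows-↭⁻ 1 _ _ (rowLists-lengths F G)
    (subst₂ _↭_ (forgetColour-cellsFrom F) (forgetColour-cellsFrom G)
      (sameLetters⇒↭ (cellsFrom 1 F) (cellsFrom 1 G) eq))

-- The circle

Precedes : Cell n → Cell n → Set
Precedes (a , d) (b , e) = d Fin.< e ⊎ (d ≡ e × b ≺ a)

-- `circle` forgets in which row an entry lies; the cells keep the row, which comparisons of `rank`
-- require.
circleCells : List (Cell n) → List (Cell n)
circleCells C = concat (List.tabulate λ e → map (_, e) (reverse (sort (rowAt C e))))

map-proj₁-circleCells : (C : List (Cell n)) → map proj₁ (circleCells C) ≡ circle (place C)
map-proj₁-circleCells C = begin
  map proj₁ (circleCells C) ≡⟨ List.concat-map (List.tabulate λ e → map (_, e) (reverse (sort (rowAt C e)))) ⟨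
  concat (map (map proj₁) (List.tabulate λ e → map (_, e) (reverse (sort (rowAt C e)))))
    ≡⟨ cong concat (List.map-tabulate (λ e → map (_, e) (reverse (sort (rowAt C e)))) (map proj₁)) ⟩
  concat (List.tabulate λ e → map proj₁ (map (_, e) (reverse (sort (rowAt C e)))))
    ≡⟨ cong concat (List.tabulate-cong λ e → map-proj₁-tag e (reverse (sort (rowAt C e)))) ⟩
  concat (List.tabulate (reverse ∘ sort ∘ rowAt C))
    ≡⟨ cong concat (List.map-tabulate (sort ∘ rowAt C) reverse) ⟨
  concat (map reverse (List.tabulate (sort ∘ rowAt C)))
    ≡⟨ cong (concat ∘ map reverse) (toList-tabulate (sort ∘ rowAt C)) ⟨
  circle (place C) ∎
  where open ≡-Reasoning

circleCells-↭ : (C : List (Cell n)) → circleCells C ↭ C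
circleCells-↭ C = ↭-trans (concat-tabulate-↭ row) (concat-fibres proj₂ C)
  where
  row : ∀ e → map (_, e) (reverse (sort (rowAt C e))) ↭ fibre proj₂ C e
  row e = ↭-trans (map⁺ (_, e) (↭-trans (↭-reverse _) (sort-↭ (rowAt C e)))) (↭-reflexive (retag C e))

-- Sorting alone gives a weak order inside a row; it becomes strict because no coloured letter is
-- repeated.
circleCells-sorted : (C : List (Cell n)) → Unique (map proj₁ C) → AllPairs Precedes (circleCells C)
circleCells-sorted C u = AllPairs.concat⁺
  (All.tabulate⁺ λ e → AllPairs.map⁺ (AllPairs.map (λ b≺a → inj₂ (refl , b≺a)) (AllPairs-reverse (strict e))))
  (AllPairs.tabulate⁺-< λ {d} {e} d<e → All.map⁺ (All.universal
    (λ a → All.map⁺ (All.universal (λ b → inj₁ d<e) (reverse (sort (rowAt C e))))) (reverse (sort (rowAt C d)))))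
  where
  unique : ∀ e → Unique (sort (rowAt C e))
  unique e = Unique-resp-↭ (↭-sym (sort-↭ (rowAt C e)))
    (AllPairs.map⁺ (AllPairs.filter⁺ _ (AllPairs.map⁻ u)))
  ≼⇒≺ : ∀ {a b} → (a ≼ b) × a ≢ b → a ≺ b
  ≼⇒≺ (inj₁ a≺b , _)             = a≺b
  ≼⇒≺ (inj₂ (refl , refl) , a≢b) = contradiction refl a≢b
  strict : ∀ e → AllPairs _≺_ (sort (rowAt C e))
  strict e = AllPairs.map ≼⇒≺ (AllPairs.zip (sort-AllPairs (rowAt C e) , unique e))

-- Cyclic order of the rows and the selection rule

-- Compares rows in cyclic order starting from row w, so that next w is a
-- minimum of rank (suc (toℕ w)) and smallest a minimum of rank 0.
rank : ℕ → Fin n → ℕ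
rank {n} w e = if does (w ℕ.≤? toℕ e) then toℕ e else n + toℕ e

module _ {w : ℕ} {e : Fin n} where

  rank-≥ : w ≤ toℕ e → rank w e ≡ toℕ e
  rank-≥ w≤e rewrite dec-true (w ℕ.≤? toℕ e) w≤e = refl

  rank-< : toℕ e < w → rank w e ≡ n + toℕ e
  rank-< e<w rewrite dec-false (w ℕ.≤? toℕ e) (ℕ.<⇒≱ e<w) = refl

toℕ<n+ : ∀ {n} (d : Fin n) k → toℕ d < n + k
toℕ<n+ d k = ℕ.<-≤-trans (Fin.toℕ<n d) (ℕ.m≤m+n _ k)

-- Rows from `w` on keep ranks below `n`, the others are shifted to ranks at least `n`, so the two
-- kinds never meet.
rank-injective : ∀ w {d e : Fin n} → rank w d ≡ rank w e → d ≡ e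
rank-injective {n} w {d} {e} eq with w ℕ.≤? toℕ d | w ℕ.≤? toℕ e
... | yes w≤d | yes w≤e = Fin.toℕ-injective (subst₂ _≡_ (rank-≥ w≤d) (rank-≥ w≤e) eq)
... | yes w≤d | no w≰e  =
  contradiction (subst₂ _≡_ (rank-≥ w≤d) (rank-< (ℕ.≰⇒> w≰e)) eq) (ℕ.<⇒≢ (toℕ<n+ d (toℕ e)))
... | no w≰d  | yes w≤e =
  contradiction (subst₂ _≡_ (rank-≥ w≤e) (rank-< (ℕ.≰⇒> w≰d)) (sym eq)) (ℕ.<⇒≢ (toℕ<n+ e (toℕ d)))
... | no w≰d  | no w≰e  = Fin.toℕ-injective (ℕ.+-cancelˡ-≡ n _ _
  (subst₂ _≡_ (rank-< (ℕ.≰⇒> w≰d)) (rank-< (ℕ.≰⇒> w≰e)) eq))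

Foremost : ℕ → Fin n → List (Fin n) → Set
Foremost w v = All (λ u → rank w v ≤ rank w u)

-- An entry may be repeated in a row, but its value is fixed: two minima have equal rank, and
-- `rank-injective` applies.
foremost-unique : ∀ w {v v′ : Fin n} {vs vs′} → Foremost w v vs → Foremost w v′ vs′ →
  v ∷ vs ↭ v′ ∷ vs′ → v ≡ v′
foremost-unique w f f′ p = rank-injective w (ℕ.≤-antisym
  (All.lookup (ℕ.≤-refl ∷ f) (∈-resp-↭ (↭-sym p) (here refl)))
  (All.lookup (ℕ.≤-refl ∷ f′) (∈-resp-↭ p (here refl))))

exists-foremost : ∀ w (y : Fin n) ys → ∃[ v ] ∃[ vs ] v ∷ vs ↭ y ∷ ys × Foremost w v vs
exists-foremost w y []        = y , [] , ↭-refl , []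
exists-foremost w y (y′ ∷ ys) with v , vs , p , f ← exists-foremost w y′ ys
  with ℕ.≤-total (rank w y) (rank w v)
... | inj₁ y≤v = y , y′ ∷ ys , ↭-refl ,
  Perm.All-resp-↭ p (y≤v ∷ All.map (ℕ.≤-trans y≤v) f)
... | inj₂ v≤y = v , y ∷ vs , ↭-trans (swap v y ↭-refl) (prep y p) , v≤y ∷ f

module _ {n : ℕ} where

  open Data.List.Extrema (Fin.≤-totalOrder n) using (min; min≤xs; min≤⊤; argmin-sel)

  smallest-∈ : ∀ y ys → smallest y ys ∈ y ∷ ys
  smallest-∈ y ys with argmin-sel id y ys
  ... | inj₁ eq = here eq
  ... | inj₂ m∈ = there m∈

  smallest-≤ : ∀ y ys → All (λ u → smallest y ys Fin.≤ u) (y ∷ ys)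
  smallest-≤ y ys = min≤⊤ y ys ∷ min≤xs y ys

  next-∈ : ∀ w y ys → next w y ys ∈ y ∷ ys
  next-∈ w y ys with filter (w Fin.<?_) (y ∷ ys) in eq
  ... | []     = smallest-∈ y ys
  ... | z ∷ zs = proj₁ (∈-filter⁻ (w Fin.<?_) (subst (smallest z zs ∈_) (sym eq) (smallest-∈ z zs)))

  smallest-foremost : ∀ y ys → Foremost 0 (smallest y ys) (y ∷ ys)
  smallest-foremost = smallest-≤

  -- The filter keeps exactly the entries whose rank is not shifted by `n`. If there are any, their
  -- minimum beats all shifted ones; if there are none, every rank is shifted and the overall
  -- minimum wins. The successor reflects that the next letter has to be strictly larger than `w`.
  next-foremost : ∀ w y ys → Foremost (suc (toℕ w)) (next w y ys) (y ∷ ys)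
  next-foremost w y ys with filter (w Fin.<?_) (y ∷ ys) in eq
  ... | [] = All.tabulate λ u∈ → subst₂ _≤_ (sym (low (smallest-∈ y ys))) (sym (low u∈))
    (ℕ.+-monoʳ-≤ n (All.lookup (smallest-≤ y ys) u∈))
    where
    low : ∀ {u} → u ∈ y ∷ ys → rank (suc (toℕ w)) u ≡ n + toℕ u
    low {u} u∈ = rank-< (s≤s (ℕ.≮⇒≥ λ w<u →
      ¬∈[] (subst (u ∈_) eq (∈-filter⁺ (w Fin.<?_) u∈ w<u))))
      where
      ¬∈[] : ¬ (u ∈ [])
      ¬∈[] ()
  ... | z ∷ zs = All.tabulate λ u∈ → case u∈
    where
    v∈ : smallest z zs ∈ filter (w Fin.<?_) (y ∷ ys)
    v∈ = subst (smallest z zs ∈_) (sym eq) (smallest-∈ z zs)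
    high : w Fin.< smallest z zs
    high = proj₂ (∈-filter⁻ (w Fin.<?_) {xs = y ∷ ys} v∈)
    case : ∀ {u} → u ∈ y ∷ ys → rank (suc (toℕ w)) (smallest z zs) ≤ rank (suc (toℕ w)) u
    case {u} u∈ with w Fin.<? u
    ... | yes w<u = subst₂ _≤_ (sym (rank-≥ high)) (sym (rank-≥ w<u))
      (All.lookup (smallest-≤ z zs) (subst (u ∈_) eq (∈-filter⁺ (w Fin.<?_) u∈ w<u)))
    ... | no w≮u  = subst₂ _≤_ (sym (rank-≥ high)) (sym (rank-< (s≤s (ℕ.≮⇒≥ w≮u))))
      (ℕ.<⇒≤ (toℕ<n+ (smallest z zs) _))

  remove-↭ : ∀ {v : Fin n} ys → v ∈ ys → v ∷ remove v ys ↭ ys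
  remove-↭ {v} (y ∷ ys) v∈ with v Fin.≟ y
  ... | yes refl = ↭-refl
  remove-↭ {v} (y ∷ ys) (here v≡y) | no v≢y = contradiction v≡y v≢y
  remove-↭ {v} (y ∷ ys) (there v∈) | no v≢y = ↭-trans (swap v y ↭-refl) (prep y (remove-↭ ys v∈))

-- Tables: the i-th entry of the x-th list is the row of the coloured letter x_i

-- Selected 0 R: the first column of R is the first word selected from R.
data Selected {n : ℕ} (w : ℕ) : List (List (Fin n)) → Set where
  []   : Selected w []
  stop : ∀ {rows} → Selected w ([] ∷ rows)
  _∷_  : ∀ {v vs rows} → Foremost w v vs → Selected (suc (toℕ v)) rows →
         Selected w ((v ∷ vs) ∷ rows)

heads : List (List (Fin n)) → List (Fin n)
heads []                = []
heads ([] ∷ rows)       = []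
heads ((v ∷ vs) ∷ rows) = v ∷ heads rows

Decreasing : List (List (Fin n)) → Set
Decreasing = AllPairs (λ xs ys → length ys ≤ length xs)

tails : List (List (Fin n)) → List (List (Fin n))
tails = map (drop 1)

-- Column `i` carries the colour `suc i`, so `drop i` leaves the colours at least `suc i`. Once all
-- columns are exhausted the condition holds by `stop` or `[]`.
Faithful : List (List (Fin n)) → Set
Faithful rows = ∀ i → Selected 0 (map (drop i) rows)

tails-drop : ∀ i (rows : List (List (Fin n))) → map (drop (suc i)) rows ≡ map (drop i) (tails rows)
tails-drop i rows = trans (List.map-cong drop-suc rows) (List.map-∘ rows)
  where
  drop-suc : (es : List (Fin _)) → drop (suc i) es ≡ drop i (drop 1 es)
  drop-suc []       = sym (List.drop-[] i)
  drop-suc (e ∷ es) = refl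

faithful-tails : {rows : List (List (Fin n))} → Faithful rows → Faithful (tails rows)
faithful-tails {rows = rows} f i = subst (Selected 0) (tails-drop i rows) (f (suc i))

length-drop₁-mono : {xs ys : List (Fin n)} →
  length ys ≤ length xs → length (drop 1 ys) ≤ length (drop 1 xs)
length-drop₁-mono {xs = xs} {ys} p =
  subst₂ _≤_ (sym (List.length-drop 1 ys)) (sym (List.length-drop 1 xs)) (ℕ.∸-monoˡ-≤ 1 p)

decreasing-tails : {rows : List (List (Fin n))} → Decreasing rows → Decreasing (tails rows)
decreasing-tails d = AllPairs.map⁺ (AllPairs.map (λ {xs} {ys} → length-drop₁-mono {xs = xs} {ys}) d)

bounded-tails : ∀ {k} {rows : List (List (Fin n))} → All (λ row → length row ≤ suc k) rows →
  All (λ row → length row ≤ k) (tails rows)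
bounded-tails = All.map⁺ ∘ All.map λ {row} p →
  subst (_≤ _) (sym (List.length-drop 1 row)) (ℕ.∸-monoˡ-≤ 1 p)

empty-rows : {rows : List (List (Fin n))} → All (λ row → length row ≤ 0) rows → tails rows ≡ rows
empty-rows []                = refl
empty-rows (_∷_ {[]} z≤n ps) = cong ([] ∷_) (empty-rows ps)

foremost⇒≡ : ∀ {w u} {v y : Fin n} {vs ys} → Foremost w v vs → v ∷ vs ↭ y ∷ ys →
  u ∈ y ∷ ys → Foremost w u (y ∷ ys) → u ≡ v × vs ↭ remove u (y ∷ ys)
foremost⇒≡ {w = w} {u} {v} {y} {vs} {ys} f p u∈ f′ =
  u≡v , drop-∷ (↭-trans p (↭-trans (↭-sym q) (↭-reflexive (cong (_∷ remove u (y ∷ ys)) u≡v))))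
  where
  q : u ∷ remove u (y ∷ ys) ↭ y ∷ ys
  q = remove-↭ (y ∷ ys) u∈
  u≡v : u ≡ v
  u≡v = foremost-unique w (All.tail (Perm.All-resp-↭ (↭-sym q) f′)) f (↭-trans q (↭-sym p))

≤0-rows : {rows : List (List (Fin n))} → Decreasing ([] ∷ rows) → All (λ row → length row ≤ 0) rows
≤0-rows (ps ∷ _) = ps

-- Selection sees each row only as a multiset, so it can run on `G` although the table `F` lists the
-- same entries in another order. The second component re-establishes this hypothesis for the next
-- word.
selectAfter≡ : ∀ {w} {F G : List (List (Fin n))} → Selected (suc (toℕ w)) F → Decreasing F →
  Pointwise _↭_ F G →
  proj₁ (selectAfter w G) ≡ heads F × Pointwise _↭_ (tails F) (proj₂ (selectAfter w G))
selectAfter≡ [] d [] = refl , []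
-- Selection leaves everything after an empty row untouched. As lengths decrease, the rest of `F` is
-- empty too, so `tails` changes nothing either.
selectAfter≡ (stop {rows}) d (_∷_ {y = row} p ps) with refl ← Perm.↭-empty-inv (↭-sym p) =
  refl , ↭-refl ∷ subst (λ rows′ → Pointwise _↭_ rows′ _) (sym (empty-rows (≤0-rows d))) ps
selectAfter≡ (f ∷ s) d (_∷_ {y = []} p ps) = contradiction p Perm.¬x∷xs↭[]
selectAfter≡ {w = w} (f ∷ s) (_ ∷ d) (_∷_ {y = y ∷ ys} p ps)
  with eq , q ← foremost⇒≡ f p (next-∈ w y ys) (next-foremost w y ys)
  with next w y ys
... | v with refl ← eq | eqs , qs ← selectAfter≡ s d ps = cong (v ∷_) eqs , q ∷ qs

select≡ : ∀ {F G : List (List (Fin n))} → Selected 0 F → Decreasing F → Pointwise _↭_ F G →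
  proj₁ (select G) ≡ heads F × Pointwise _↭_ (tails F) (proj₂ (select G))
select≡ [] d [] = refl , []
select≡ (stop {rows}) d (_∷_ {y = row} p ps) with refl ← Perm.↭-empty-inv (↭-sym p) =
  refl , ↭-refl ∷ subst (λ rows′ → Pointwise _↭_ rows′ _) (sym (empty-rows (≤0-rows d))) ps
select≡ (f ∷ s) d (_∷_ {y = []} p ps) = contradiction p Perm.¬x∷xs↭[]
select≡ (f ∷ s) (_ ∷ d) (_∷_ {y = y ∷ ys} p ps)
  with eq , q ← foremost⇒≡ {w = 0} f p (smallest-∈ y ys) (smallest-foremost y ys)
  with smallest y ys
... | v with refl ← eq | eqs , qs ← selectAfter≡ s d ps = cong (v ∷_) eqs , q ∷ qs

-- After each round the leftover of `G` is again a permutation of `tails F` row by row, and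
-- `tails F` is again faithful and decreasing.
selections≡ : ∀ k {F G : List (List (Fin n))} → Faithful F → Decreasing F → Pointwise _↭_ F G →
  selections k G ≡ List.applyUpTo (λ i → heads (map (drop i) F)) k
selections≡ zero    f d p = refl
selections≡ (suc k) {F} {G} f d p
  with eq , q ← select≡ (subst (Selected 0) (List.map-id F) (f 0)) d p
  = cong₂ _∷_ (trans eq (cong heads (sym (List.map-id F))))
      (trans (selections≡ k (faithful-tails f) (decreasing-tails d) q)
        (applyUpTo-cong (λ i → cong heads (sym (tails-drop i F))) k))
  where
  applyUpTo-cong : ∀ {f g : ℕ → List (Fin _)} → f ≗ g → ∀ k → List.applyUpTo f k ≡ List.applyUpTo g k
  applyUpTo-cong f≗g zero    = refl
  applyUpTo-cong f≗g (suc k) = cong₂ _∷_ (f≗g 0) (applyUpTo-cong (f≗g ∘ suc) k)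

-- Existence and uniqueness of faithful tables

selected-exists : ∀ w (G : List (List (Fin n))) → ∃[ H ] Pointwise _↭_ H G × Selected w H
selected-exists w []             = [] , [] , []
selected-exists w ([] ∷ G)       = [] ∷ G , Pointwise.refl ↭-refl , stop
selected-exists w ((y ∷ ys) ∷ G)
  with v , vs , p , f ← exists-foremost w y ys
  with H , q , s ← selected-exists (suc (toℕ v)) G
  = (v ∷ vs) ∷ H , p ∷ q , f ∷ s

-- `Selected` constrains the first column and looks at the rest of a row only as a multiset. The
-- first column of `H` can therefore be put in front of any rearrangement of its other columns.
selected-glue : ∀ {w} {H F : List (List (Fin n))} → Selected w H → Pointwise _↭_ F (tails H) →
  ∃[ F′ ] Pointwise _↭_ F′ H × Selected w F′ × tails F′ ≡ F
selected-glue [] [] = [] , [] , [] , refl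
-- `Selected` says nothing about the rows after an empty one, so these are glued by a separate
-- recursion.
selected-glue (stop {rows}) (p ∷ ps) with refl ← Perm.↭-empty-inv p =
  _ , ↭-refl ∷ proj₁ (proj₂ (glue rows ps)) , stop , cong ([] ∷_) (proj₂ (proj₂ (glue rows ps)))
  where
  glue : ∀ (H : List (List (Fin _))) {F} → Pointwise _↭_ F (tails H) →
    ∃[ F′ ] Pointwise _↭_ F′ H × tails F′ ≡ F
  glue [] [] = [] , [] , refl
  glue ([] ∷ H) (p ∷ ps) with F′ , q , refl ← glue H ps | refl ← Perm.↭-empty-inv p =
    [] ∷ F′ , ↭-refl ∷ q , refl
  glue ((v ∷ vs) ∷ H) {row ∷ _} (p ∷ ps) with F′ , q , refl ← glue H ps =
    (v ∷ row) ∷ F′ , prep v p ∷ q , refl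
selected-glue {F = row ∷ _} (_∷_ {v} f s) (p ∷ ps) with F′ , q , s′ , refl ← selected-glue s ps =
  (v ∷ row) ∷ F′ , prep v p ∷ q , Perm.All-resp-↭ (↭-sym p) f ∷ s′ , refl

bounded-↭ : ∀ {k} {H G : List (List (Fin n))} → Pointwise _↭_ H G →
  All (λ row → length row ≤ k) G → All (λ row → length row ≤ k) H
bounded-↭ []       []       = []
bounded-↭ (p ∷ ps) (b ∷ bs) = subst (_≤ _) (sym (Perm.↭-length p)) b ∷ bounded-↭ ps bs

-- The first column is chosen from `G`, the leftover is arranged faithfully by recursion, and the
-- two are glued. The bound `k` counts the columns that may still be open.
faithful-exists : ∀ k (G : List (List (Fin n))) → All (λ row → length row ≤ k) G →
  ∃[ F ] Pointwise _↭_ F G × Faithful F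
faithful-exists zero G b = G , Pointwise.refl ↭-refl , λ i → empty i b
  where
  empty : ∀ i {rows : List (List (Fin _))} → All (λ row → length row ≤ 0) rows →
    Selected 0 (map (drop i) rows)
  empty i []               = []
  empty i (_∷_ {[]} {rows} z≤n _) =
    subst (λ row → Selected 0 (row ∷ map (drop i) rows)) (sym (List.drop-[] i)) stop
faithful-exists (suc k) G b
  with H , H~G , s ← selected-exists 0 G
  with F , F~tails , f ← faithful-exists k (tails H) (bounded-tails (bounded-↭ H~G b))
  with F′ , F′~H , s′ , refl ← selected-glue s F~tails
  = F′ , Pointwise.transitive ↭-trans F′~H H~G , λ where
      zero    → subst (Selected 0) (sym (List.map-id F′)) s′
      (suc i) → subst (Selected 0) (sym (tails-drop i F′)) (f i)

empty-↭ : ∀ {rows rows′ : List (List (Fin n))} → All (λ row → length row ≤ 0) rows →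
  Pointwise _↭_ rows rows′ → rows ≡ rows′
empty-↭ []                []       = refl
empty-↭ (_∷_ {[]} z≤n bs) (p ∷ ps) = cong₂ _∷_ (sym (Perm.↭-empty-inv (↭-sym p))) (empty-↭ bs ps)

-- The first columns agree at once, but the tails so far only up to permutation. Hence the second
-- component is an implication, whose premise comes from the recursion over columns in
-- `faithful-unique`.
selected-unique : ∀ {w} {F G : List (List (Fin n))} → Selected w F → Selected w G → Decreasing F →
  Pointwise _↭_ F G → Pointwise _↭_ (tails F) (tails G) × (tails F ≡ tails G → F ≡ G)
selected-unique [] [] d [] = [] , λ _ → refl
selected-unique (stop {rows}) _ d (p ∷ ps) with refl ← Perm.↭-empty-inv (↭-sym p) =
  subst (λ rows′ → Pointwise _↭_ (tails ([] ∷ rows)) (tails ([] ∷ rows′))) rows≡ (Pointwise.refl ↭-refl) ,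
  λ _ → cong ([] ∷_) rows≡
  where
  rows≡ = empty-↭ (≤0-rows d) ps
selected-unique (f ∷ s) stop d (p ∷ ps) = contradiction p Perm.¬x∷xs↭[]
selected-unique {w = w} (f ∷ s) (f′ ∷ s′) (_ ∷ d) (p ∷ ps) with refl ← foremost-unique w f f′ p
  with q , eq ← selected-unique s s′ d ps
  = drop-∷ p ∷ q , λ tails≡ → cong₂ _∷_ (cong (_ ∷_) (List.∷-injectiveˡ tails≡)) (eq (List.∷-injectiveʳ tails≡))

faithful-unique : ∀ k {F G : List (List (Fin n))} → Faithful F → Faithful G → Decreasing F →
  Pointwise _↭_ F G → All (λ row → length row ≤ k) F → F ≡ G
faithful-unique zero f g d p b = empty-↭ b p
faithful-unique (suc k) {F} {G} f g d p b
  with q , eq ← selected-unique (subst (Selected 0) (List.map-id F) (f 0))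
                                (subst (Selected 0) (List.map-id G) (g 0)) d p
  = eq (faithful-unique k (faithful-tails f) (faithful-tails g) (decreasing-tails d) q (bounded-tails b))

-- The circle read from a given row on

RankPrecedes : ℕ → Cell n → Cell n → Set
RankPrecedes w (a , d) (b , e) = rank w d < rank w e ⊎ (rank w d ≡ rank w e × colour a < colour b)

-- Reading `Ys` before `Xs` meets first the rows with unshifted rank and then the shifted ones.
-- Restricting to one letter `y` turns the decreasing prismatic order inside a row into increasing
-- colour, which settles ties of rank.
rotate-sorted : ∀ w y {Xs Ys : List (Cell n)} →
  AllPairs Precedes Xs → AllPairs Precedes Ys →
  (∀ {a e} → (a , e) ∈ Xs → letter a ≡ y → toℕ e < w) →
  (∀ {a e} → (a , e) ∈ Ys → letter a ≡ y → w ≤ toℕ e) →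
  AllPairs (RankPrecedes w) (filter (λ p → letter (proj₁ p) ℕ.≟ y) (Ys ++ Xs))
rotate-sorted {n} w y {Xs} {Ys} sXs sYs low high =
  subst (AllPairs (RankPrecedes w)) (sym (List.filter-++ y? Ys Xs)) (AllPairs.++⁺
    (sorted toℕ
      (λ p∈ → let p∈Ys , eq = ∈-filter⁻ y? {xs = Ys} p∈ in rank-≥ (high p∈Ys eq) , eq)
      id (AllPairs.filter⁺ y? sYs))
    (sorted (λ e → n + toℕ e)
      (λ p∈ → let p∈Xs , eq = ∈-filter⁻ y? {xs = Xs} p∈ in rank-< (low p∈Xs eq) , eq)
      (ℕ.+-monoʳ-< n) (AllPairs.filter⁺ y? sXs))
    (All.tabulate λ p∈ → All.tabulate λ q∈ →
      let p∈Ys , eq  = ∈-filter⁻ y? {xs = Ys} p∈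
          q∈Xs , eq′ = ∈-filter⁻ y? {xs = Xs} q∈
      in inj₁ (subst₂ _<_ (sym (rank-≥ (high p∈Ys eq))) (sym (rank-< (low q∈Xs eq′))) (toℕ<n+ _ _))))
  where
  y? = λ (p : Cell n) → letter (proj₁ p) ℕ.≟ y

  sorted : ∀ {Zs : List (Cell n)} (f : Fin n → ℕ) →
    (∀ {p} → p ∈ Zs → rank w (proj₂ p) ≡ f (proj₂ p) × letter (proj₁ p) ≡ y) →
    (∀ {d e} → toℕ d < toℕ e → f d < f e) →
    AllPairs Precedes Zs → AllPairs (RankPrecedes w) Zs
  sorted f r mono [] = []
  sorted f r mono (ps ∷ pss) =
    All.tabulate (λ q∈ → step (r (here refl)) (r (there q∈)) (All.lookup ps q∈)) ∷
    sorted f (r ∘ there) mono pss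
    where
    step : ∀ {p q} → rank w (proj₂ p) ≡ f (proj₂ p) × letter (proj₁ p) ≡ y →
      rank w (proj₂ q) ≡ f (proj₂ q) × letter (proj₁ q) ≡ y → Precedes p q → RankPrecedes w p q
    step (rp , _)    (rq , _)  (inj₁ d<e) = inj₁ (subst₂ _<_ (sym rp) (sym rq) (mono d<e))
    step (rp , refl) (rq , lq) (inj₂ (d≡e , inj₁ y<y)) = contradiction lq (ℕ.<⇒≢ y<y)
    step (rp , _)    (rq , _)  (inj₂ (d≡e , inj₂ (_ , k<l))) = inj₂ (trans rp (trans (cong f d≡e) (sym rq)) , k<l)

module _ (C : List (Cell n)) where

  -- Among the letters y of colour at least i, the one of colour i comes first
  -- when the circle is read from row w on; HasFirst also claims its existence.
  FirstHas HasFirst : ℕ → ℕ → ℕ → Set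
  FirstHas i y w = ∀ {v} → ((y , i) , v) ∈ C → ∀ {k u} → ((y , k) , u) ∈ C → i ≤ k → rank w v ≤ rank w u
  HasFirst i y w = ∀ {k u} → ((y , k) , u) ∈ C → i ≤ k →
    ∃[ v ] ((y , i) , v) ∈ C × rank w v ≤ rank w u

  -- Ys ++ Xs is the circle of the colours at least i, read from some entry in row
  -- w ∸ 1 on, or from ⋆ on if w is 0.
  record Arc (i y w : ℕ) (Xs Ys : List (Cell n)) : Set where
    field
      sortedˡ  : AllPairs Precedes Xs
      sortedʳ  : AllPairs Precedes Ys
      low      : ∀ {a e} → (a , e) ∈ Xs → letter a ≡ y → toℕ e < w
      high     : ∀ {a e} → (a , e) ∈ Ys → letter a ≡ y → w ≤ toℕ e
      sound    : ∀ {p} → p ∈ Ys ++ Xs → p ∈ C × i ≤ colour (proj₁ p)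
      complete : ∀ {k e} → ((y , k) , e) ∈ C → i ≤ k → ((y , k) , e) ∈ Ys ++ Xs

module _ (C : List (Cell n)) (unique : Unique (map proj₁ C)) where

  module _ {i y w Xs Ys} (arc : Arc C i y w Xs Ys) where

    open Arc arc

    private
      y? : (p : Cell n) → _
      y? p = letter (proj₁ p) ℕ.≟ y

      arcFirst : Maybe ColouredLetter
      arcFirst = first y (map proj₁ Ys ++ map proj₁ Xs)

      entries : List (Cell n)
      entries = filter y? (Ys ++ Xs)

      arcFirst≡ : arcFirst ≡ List.head (map proj₁ entries)
      arcFirst≡ = cong List.head (trans
        (cong (filter _) (sym (List.map-++ proj₁ Ys Xs))) (filter-map _ proj₁ (Ys ++ Xs)))

      entries-sorted : AllPairs (RankPrecedes w) entries
      entries-sorted = rotate-sorted w y sortedˡ sortedʳ low high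

      entries-sound : ∀ {p} → p ∈ entries → p ∈ C × i ≤ colour (proj₁ p) × letter (proj₁ p) ≡ y
      entries-sound p∈ with p∈′ , eq ← ∈-filter⁻ y? {xs = Ys ++ Xs} p∈ with p∈C , i≤ ← sound p∈′ = p∈C , i≤ , eq

      entries-complete : ∀ {k e} → ((y , k) , e) ∈ C → i ≤ k → ((y , k) , e) ∈ entries
      entries-complete p∈ i≤k = ∈-filter⁺ y? (complete p∈ i≤k) refl

    -- The head of the entries sorted by rank has minimal rank. Since its colour is `i` and coloured
    -- letters are not repeated, it is the given cell in row `v`.
    first⇒FirstHas : Maybe.All (λ a → colour a ≡ i) arcFirst → FirstHas C i y w
    first⇒FirstHas h v∈ u∈ i≤k = go entries-sorted entries-sound (subst (Maybe.All _) arcFirst≡ h)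
        v∈ (entries-complete v∈ ℕ.≤-refl) (entries-complete u∈ i≤k)
      where
      go : ∀ {Zs p q} → AllPairs (RankPrecedes w) Zs →
        (∀ {p} → p ∈ Zs → p ∈ C × i ≤ colour (proj₁ p) × letter (proj₁ p) ≡ y) →
        Maybe.All (λ a → colour a ≡ i) (List.head (map proj₁ Zs)) →
        ((y , i) , p) ∈ C → ((y , i) , p) ∈ Zs → q ∈ Zs → rank w p ≤ rank w (proj₂ q)
      go {z ∷ Zs} (zs ∷ _) s (Maybe.just refl) p∈C p∈ q∈
        with z∈ , _ , refl ← s (here refl)
        with refl ← Unique-map⇒injective proj₁ unique z∈ p∈C refl
        with q∈
      ... | here refl = ℕ.≤-refl
      ... | there q∈′ with All.lookup zs q∈′
      ... | inj₁ lt       = ℕ.<⇒≤ lt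
      ... | inj₂ (eq , _) = ℕ.≤-reflexive eq

    -- If the cell of colour `i` came after the head, its rank would be larger, contradicting `h`,
    -- or equal with the head of smaller colour, contradicting that all colours are at least `i`.
    HasFirst⇒first : HasFirst C i y w → Maybe.All (λ a → colour a ≡ i) arcFirst
    HasFirst⇒first h = subst (Maybe.All _) (sym arcFirst≡) (go entries-sorted entries-sound entries-complete)
      where
      go : ∀ {Zs} → AllPairs (RankPrecedes w) Zs →
        (∀ {p} → p ∈ Zs → p ∈ C × i ≤ colour (proj₁ p) × letter (proj₁ p) ≡ y) →
        (∀ {k e} → ((y , k) , e) ∈ C → i ≤ k → ((y , k) , e) ∈ Zs) →
        Maybe.All (λ a → colour a ≡ i) (List.head (map proj₁ Zs))
      go [] s c = Maybe.nothing
      go {z ∷ Zs} (zs ∷ _) s c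
        with z∈ , i≤ , refl ← s (here refl)
        with v , v∈ , v≤ ← h z∈ i≤
        with c v∈ ℕ.≤-refl
      ... | here refl = Maybe.just refl
      ... | there v∈′ with All.lookup zs v∈′
      ... | inj₁ lt       = contradiction v≤ (ℕ.<⇒≱ lt)
      ... | inj₂ (_ , lt) = contradiction i≤ (ℕ.<⇒≱ lt)

  fromColour : ℕ → List (Cell n)
  fromColour i = filter (λ p → i ℕ.≤? colour (proj₁ p)) (circleCells C)

  fromColour-circle : ∀ i → filter (λ a → i ℕ.≤? colour a) (circle (place C)) ≡ map proj₁ (fromColour i)
  fromColour-circle i =
    trans (cong (filter _) (sym (map-proj₁-circleCells C))) (filter-map _ proj₁ (circleCells C))

  fromColour-sorted : ∀ i → AllPairs Precedes (fromColour i)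
  fromColour-sorted i = AllPairs.filter⁺ _ (circleCells-sorted C unique)

  ∈-fromColour⁺ : ∀ {i p} → p ∈ C → i ≤ colour (proj₁ p) → p ∈ fromColour i
  ∈-fromColour⁺ p∈ = ∈-filter⁺ _ (∈-resp-↭ (↭-sym (circleCells-↭ C)) p∈)

  ∈-fromColour⁻ : ∀ {i p} → p ∈ fromColour i → p ∈ C × i ≤ colour (proj₁ p)
  ∈-fromColour⁻ {i} p∈ =
    let p∈circle , i≤ = ∈-filter⁻ (λ p → i ℕ.≤? colour (proj₁ p)) {xs = circleCells C} p∈
    in  ∈-resp-↭ (circleCells-↭ C) p∈circle , i≤

  startArc : ∀ i → Arc C i 1 0 [] (fromColour i)
  startArc i = record
    { sortedˡ  = []
    ; sortedʳ  = fromColour-sorted i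
    ; low      = λ ()
    ; high     = λ _ _ → z≤n
    ; sound    = λ {p} p∈ → ∈-fromColour⁻ (subst (p ∈_) (List.++-identityʳ _) p∈)
    ; complete = λ {k} {e} p∈ i≤k →
        subst (((1 , k) , e) ∈_) (sym (List.++-identityʳ _)) (∈-fromColour⁺ p∈ i≤k)
    }

  -- Inside a row larger letters come first, so a letter `suc x` in row `w` precedes the cell on the
  -- circle. Those that follow the cell lie strictly above `w`, which is why the reading counts as
  -- starting at row `suc (toℕ w)`.
  cellArc : ∀ {i x w Xs Ys} → fromColour i ≡ Xs ++ ((x , i) , w) ∷ Ys → Arc C i (suc x) (suc (toℕ w)) Xs Ys
  cellArc {i} {x} {w} {Xs} {Ys} eq
    with sX , sY , l , h ← AllPairs-++⁻ Xs (subst (AllPairs Precedes) eq (fromColour-sorted i))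
    = record
    { sortedˡ  = sX
    ; sortedʳ  = sY
    ; low      = λ a∈ la → low (All.lookup l a∈)
    ; high     = λ a∈ la → high la (All.lookup h a∈)
    ; sound    = λ {p} p∈ → ∈-fromColour⁻ (subst (p ∈_) (sym eq) (there⇒ p∈))
    ; complete = λ {k} {e} p∈ i≤k → there⇐ (subst (((suc x , k) , e) ∈_) eq (∈-fromColour⁺ p∈ i≤k)) λ ()
    }
    where
    low : ∀ {a e} → Precedes (a , e) ((x , i) , w) → toℕ e < suc (toℕ w)
    low (inj₁ e<w)        = ℕ.<-trans e<w (ℕ.n<1+n _)
    low (inj₂ (refl , _)) = ℕ.n<1+n _
    high : ∀ {a e} → letter a ≡ suc x → Precedes ((x , i) , w) (a , e) → suc (toℕ w) ≤ toℕ e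
    high la   (inj₁ w<e)                  = w<e
    high refl (inj₂ (_ , inj₁ x+1<x))     = contradiction (ℕ.<-trans (ℕ.n<1+n x) x+1<x) (ℕ.<-irrefl refl)
    high refl (inj₂ (_ , inj₂ (eq , _)))  = contradiction eq ℕ.1+n≢n
    there⇒ : ∀ {p} → p ∈ Ys ++ Xs → p ∈ Xs ++ ((x , i) , w) ∷ Ys
    there⇒ p∈ with ∈-++⁻ Ys p∈
    ... | inj₁ p∈Ys = ∈-++⁺ʳ Xs (there p∈Ys)
    ... | inj₂ p∈Xs = ∈-++⁺ˡ p∈Xs
    there⇐ : ∀ {p} → p ∈ Xs ++ ((x , i) , w) ∷ Ys → p ≢ ((x , i) , w) → p ∈ Ys ++ Xs
    there⇐ p∈ p≢ with ∈-++⁻ Xs p∈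
    ... | inj₁ p∈Xs         = ∈-++⁺ʳ Ys p∈Xs
    ... | inj₂ (here refl)  = contradiction refl p≢
    ... | inj₂ (there p∈Ys) = ∈-++⁺ˡ p∈Ys

  IsFaithful⇒start : IsFaithful (place C) → ∀ i → 1 ≤ i → FirstHas C i 1 0
  IsFaithful⇒start f i 1≤i = first⇒FirstHas (startArc i)
    (subst (Maybe.All _ ∘ first 1) (trans (fromColour-circle i) (sym (List.++-identityʳ _))) (proj₁ (f i 1≤i)))

  IsFaithful⇒step : IsFaithful (place C) → ∀ i → 1 ≤ i → ∀ {x w} → 1 ≤ x → ((x , i) , w) ∈ C →
    FirstHas C i (suc x) (suc (toℕ w))
  IsFaithful⇒step f i 1≤i {x} {w} 1≤x c∈
    with Xs , Ys , eq ← ∈-∃++ (∈-fromColour⁺ c∈ ℕ.≤-refl)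
    = first⇒FirstHas (cellArc eq) (proj₂ (f i 1≤i) x 1≤x (map proj₁ Xs) (map proj₁ Ys)
        (trans (fromColour-circle i) (trans (cong (map proj₁) eq) (List.map-++ proj₁ Xs _))))

  IsFaithful⇐ : (∀ i → 1 ≤ i → HasFirst C i 1 0) →
    (∀ i → 1 ≤ i → ∀ {x w} → 1 ≤ x → ((x , i) , w) ∈ C → HasFirst C i (suc x) (suc (toℕ w))) →
    IsFaithful (place C)
  IsFaithful⇐ start step i 1≤i =
    subst (Maybe.All _ ∘ first 1) (trans (List.++-identityʳ _) (sym (fromColour-circle i)))
      (HasFirst⇒first (startArc i) (start i 1≤i)) ,
    λ x 1≤x xs ys eq → atCell x 1≤x (map≡++⇒ proj₁ (fromColour i) xs (trans (sym (fromColour-circle i)) eq))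
    where
    atCell : ∀ x → 1 ≤ x → ∀ {xs ys} →
      ∃[ Xs ] ∃[ Zs ] fromColour i ≡ Xs ++ Zs × map proj₁ Xs ≡ xs × map proj₁ Zs ≡ (x , i) ∷ ys →
      Maybe.All (λ a → colour a ≡ i) (first (suc x) (ys ++ xs))
    atCell x 1≤x (Xs , (_ , w) ∷ Ys , eq , refl , refl) = HasFirst⇒first (cellArc eq)
      (step i 1≤i 1≤x (proj₁ (∈-fromColour⁻ (subst (_ ∈_) (sym eq) (∈-++⁺ʳ Xs (here refl))))))

-- Columns of a table and colours of its cells

∈-rowCells⁺ : ∀ {x} c i (row : List (Fin n)) {u} → u ∈ drop i row →
  ∃[ k ] c + i ≤ k × ((x , k) , u) ∈ rowCells x c row
∈-rowCells⁺ c zero    (e ∷ row) (here refl) = c , ℕ.≤-reflexive (ℕ.+-identityʳ c) , here refl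
∈-rowCells⁺ c zero    (e ∷ row) (there u∈)  with k , c<k , p∈ ← ∈-rowCells⁺ (suc c) zero row u∈ =
  k , ℕ.<⇒≤ c<k , there p∈
∈-rowCells⁺ c (suc i) (e ∷ row) u∈          with k , c≤k , p∈ ← ∈-rowCells⁺ (suc c) i row u∈ =
  k , subst (_≤ k) (sym (ℕ.+-suc c i)) c≤k , there p∈

head-rowCells : ∀ {x} c i (row : List (Fin n)) {v vs} → drop i row ≡ v ∷ vs →
  ((x , c + i) , v) ∈ rowCells x c row
head-rowCells c zero    (e ∷ row) refl = here (cong (λ k → (_ , k) , e) (ℕ.+-identityʳ c))
head-rowCells {x = x} c (suc i) (e ∷ row) {v} eq =
  subst (λ k → ((x , k) , v) ∈ rowCells x c (e ∷ row)) (sym (ℕ.+-suc c i)) (there (head-rowCells (suc c) i row eq))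

rowCells-bounds : ∀ {x} c (row : List (Fin n)) {p} → p ∈ rowCells x c row →
  letter (proj₁ p) ≡ x × c ≤ colour (proj₁ p)
rowCells-bounds c (e ∷ row) (here refl) = refl , ℕ.≤-refl
rowCells-bounds c (e ∷ row) (there p∈)  with eq , c<k ← rowCells-bounds (suc c) row p∈ = eq , ℕ.<⇒≤ c<k

∈-rowCells⁻ : ∀ {x y k} c i (row : List (Fin n)) {u} → ((y , k) , u) ∈ rowCells x c row →
  c + i ≤ k → u ∈ drop i row
∈-rowCells⁻ c zero    (e ∷ row) (here refl) c≤k = here refl
∈-rowCells⁻ {k = k} c zero    (e ∷ row) (there p∈)  c≤k =
  there (∈-rowCells⁻ (suc c) zero row p∈
    (subst (_≤ k) (sym (ℕ.+-identityʳ (suc c))) (proj₂ (rowCells-bounds (suc c) row p∈))))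
∈-rowCells⁻ c (suc i) (e ∷ row) (here refl) c≤k = contradiction c≤k (ℕ.<⇒≱ (ℕ.m<m+n c z<s))
∈-rowCells⁻ {k = k} c (suc i) (e ∷ row) (there p∈)  c≤k =
  ∈-rowCells⁻ (suc c) i row p∈ (subst (_≤ k) (ℕ.+-suc c i) c≤k)

rowCells-head : ∀ {x y} c i (row : List (Fin n)) {v} → ((y , c + i) , v) ∈ rowCells x c row →
  ∃[ vs ] drop i row ≡ v ∷ vs
rowCells-head c zero (e ∷ row) (here eq) = row , cong (λ p → proj₂ p ∷ row) (sym eq)
rowCells-head c zero (e ∷ row) (there p∈) =
  contradiction (proj₂ (rowCells-bounds (suc c) row p∈)) (ℕ.<⇒≱ (s≤s (ℕ.≤-reflexive (ℕ.+-identityʳ c))))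
rowCells-head c (suc i) (e ∷ row) (here eq) =
  contradiction (cong (colour ∘ proj₁) eq) λ c+1+i≡c → ℕ.<-irrefl (sym c+1+i≡c) (ℕ.m<m+n c z<s)
rowCells-head {x = x} {y} c (suc i) (e ∷ row) {v} (there p∈) =
  rowCells-head (suc c) i row (subst (λ k → ((y , k) , v) ∈ rowCells x (suc c) row) (ℕ.+-suc c i) p∈)

cells-letter : ∀ x (rows : List (List (Fin n))) {p} → p ∈ cells x rows → x ≤ letter (proj₁ p)
cells-letter x (row ∷ rows) p∈ with ∈-++⁻ (rowCells x 1 row) p∈
... | inj₁ p∈row  = ℕ.≤-reflexive (sym (proj₁ (rowCells-bounds 1 row p∈row)))
... | inj₂ p∈rows = ℕ.<⇒≤ (cells-letter (suc x) rows p∈rows)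

first-row : ∀ x row (rows : List (List (Fin n))) {k u} → ((x , k) , u) ∈ cells x (row ∷ rows) →
  ((x , k) , u) ∈ rowCells x 1 row
first-row x row rows p∈ with ∈-++⁻ (rowCells x 1 row) p∈
... | inj₁ p∈row  = p∈row
... | inj₂ p∈rows = contradiction (cells-letter (suc x) rows p∈rows) (ℕ.<-irrefl refl)

later-row : ∀ x row (rows : List (List (Fin n))) {y k u} → x ≢ y → ((y , k) , u) ∈ cells x (row ∷ rows) →
  ((y , k) , u) ∈ cells (suc x) rows
later-row x row rows x≢y p∈ with ∈-++⁻ (rowCells x 1 row) p∈
... | inj₁ p∈row  = contradiction (sym (proj₁ (rowCells-bounds 1 row p∈row))) x≢y
... | inj₂ p∈rows = p∈rows

y≢1+x : ∀ {x y k u} (rows : List (List (Fin n))) → ((x , k) , u) ∈ cells y rows → y ≢ suc x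
y≢1+x {x = x} rows q∈ refl = ℕ.1+n≰n (cells-letter (suc x) rows q∈)

drop-[]-mono : ∀ i {xs ys : List (Fin n)} → length ys ≤ length xs → drop i xs ≡ [] → drop i ys ≡ []
drop-[]-mono i {xs} {ys} le eq = List.drop-all i ys (ℕ.≤-trans le (ℕ.m∸n≡0⇒m≤n
  (trans (sym (List.length-drop i xs)) (cong length eq))))

no-cells : ∀ {x i k} {rows : List (List (Fin n))} {y u} → All (λ row → drop i row ≡ []) rows →
  ((y , k) , u) ∈ cells x rows → ¬ (suc i ≤ k)
no-cells {x = x} {i} {rows = row ∷ rows} (e ∷ es) p∈ i<k with ∈-++⁻ (rowCells x 1 row) p∈
... | inj₁ p∈row  = contradiction (subst (_ ∈_) e (∈-rowCells⁻ 1 i row p∈row i<k)) λ ()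
... | inj₂ p∈rows = no-cells es p∈rows i<k

exhausted : ∀ i {row : List (Fin n)} {rows} → Decreasing (row ∷ rows) → drop i row ≡ [] →
  All (λ row → drop i row ≡ []) rows
exhausted i {row} (ps ∷ _) eq = All.map (λ {row′} le → drop-[]-mono i {row} {row′} le eq) ps

-- Faithful tables and faithful colourings

firstRow-hasFirst : ∀ {x w i k u} (rows : List (List (Fin n))) → Selected w (map (drop i) rows) →
  ((x , k) , u) ∈ cells x rows → suc i ≤ k →
  ∃[ v ] ((x , suc i) , v) ∈ cells x rows × rank w v ≤ rank w u
firstRow-hasFirst {x = x} {i = i} (row ∷ rows) s p∈ i<k
  with drop i row in eq | s | ∈-rowCells⁻ 1 i row (first-row x row rows p∈) i<k
... | v ∷ vs | f ∷ _ | u∈ = v , ∈-++⁺ˡ (head-rowCells 1 i row eq) , All.lookup (ℕ.≤-refl ∷ f) u∈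

-- The walk through the table continues until the row of the letter `x`; its head in column `i` is
-- `w`, and from there on `Selected` speaks of `suc (toℕ w)`, whatever the starting value `w₀` was.
laterRow-hasFirst : ∀ {x y w₀ w i k u} (rows : List (List (Fin n))) → Decreasing rows → Selected w₀ (map (drop i) rows) →
  ((x , suc i) , w) ∈ cells y rows → ((suc x , k) , u) ∈ cells y rows → suc i ≤ k →
  ∃[ v ] ((suc x , suc i) , v) ∈ cells y rows × rank (suc (toℕ w)) v ≤ rank (suc (toℕ w)) u
laterRow-hasFirst {x = x} {y} {i = i} (row ∷ rows) d s q∈ p∈ i<k with y ℕ.≟ x
... | yes refl
  with vs , eq ← rowCells-head 1 i row (first-row x row rows q∈)
  with _ ∷ s′ ← subst (λ row′ → Selected _ (row′ ∷ map (drop i) rows)) eq s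
  with v , v∈ , le ← firstRow-hasFirst rows s′ (later-row x row rows (ℕ.1+n≢n ∘ sym) p∈) i<k
  = v , ∈-++⁺ʳ (rowCells x 1 row) v∈ , le
... | no y≢x
  with drop i row in eq | s
-- Column `i` has ended here, hence in all later rows, one of which should contain the cell of
-- letter `x` and colour `suc i`.
... | [] | _ = contradiction ℕ.≤-refl
  (no-cells {i = i} (exhausted i {row} d eq) (later-row y row rows y≢x q∈))
... | v ∷ vs | _ ∷ s′
  with v , v∈ , le ← laterRow-hasFirst rows (AllPairs.tail d) s′ (later-row y row rows y≢x q∈)
         (later-row y row rows (y≢1+x (row ∷ rows) q∈) p∈) i<k
  = v , ∈-++⁺ʳ (rowCells y 1 row) v∈ , le

module _ (R : List (List (Fin n))) (unique : Unique (map proj₁ (cells 1 R))) where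

  -- Every head met in column `i` is a cell of colour `suc i`, and the faithfulness condition at
  -- that cell is what the next row needs.
  IsFaithful⇒Faithful : IsFaithful (place (cells 1 R)) → Faithful R
  IsFaithful⇒Faithful f i = go 1 0 R id (s≤s z≤n) (IsFaithful⇒start (cells 1 R) unique f (suc i) (s≤s z≤n))
    where
    go : ∀ x w rows → (∀ {p} → p ∈ cells x rows → p ∈ cells 1 R) → 1 ≤ x →
      FirstHas (cells 1 R) (suc i) x w → Selected w (map (drop i) rows)
    go x w []           sub 1≤x fh = []
    go x w (row ∷ rows) sub 1≤x fh with drop i row in eq
    ... | []     = stop
    ... | v ∷ vs = All.tabulate foremost ∷
      go (suc x) (suc (toℕ v)) rows (sub ∘ ∈-++⁺ʳ (rowCells x 1 row)) (s≤s z≤n)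
        (IsFaithful⇒step (cells 1 R) unique f (suc i) (s≤s z≤n) 1≤x v∈)
      where
      v∈ : ((x , suc i) , v) ∈ cells 1 R
      v∈ = sub (∈-++⁺ˡ (head-rowCells 1 i row eq))
      foremost : ∀ {u} → u ∈ vs → rank w v ≤ rank w u
      foremost {u} u∈ with k , i<k , p∈ ← ∈-rowCells⁺ {x = x} 1 i row (subst (u ∈_) (sym eq) (there u∈)) =
        fh v∈ (sub (∈-++⁺ˡ p∈)) i<k

  Faithful⇒IsFaithful : Decreasing R → Faithful R → IsFaithful (place (cells 1 R))
  Faithful⇒IsFaithful d f = IsFaithful⇐ (cells 1 R) unique
    (λ { (suc i) _ p∈ i<k → firstRow-hasFirst R (f i) p∈ i<k })
    (λ { (suc i) _ _ q∈ p∈ i<k → laterRow-hasFirst R d (f i) q∈ p∈ i<k })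

-- Cocharge of one colour

position-here : ∀ a w → position a (a ∷ w) ≡ 0
position-here a w rewrite dec-true (a ℕ.≟ a) refl = refl

position-there : ∀ {a b} w → b ≢ a → position a (b ∷ w) ≡ suc (position a w)
position-there {a} {b} w b≢a rewrite dec-false (b ℕ.≟ a) b≢a = refl

-- Two distinct members of a sorted list come in one of two orders, and the wrong one would give
-- `R q p`. Distinct values of `f` ensure that `position` finds `p` and `q` themselves.
position-mono : (f : A → ℕ) {R : A → A → Set} {zs : List A} → AllPairs R zs → Unique (map f zs) →
  ∀ {p q} → p ∈ zs → q ∈ zs → ¬ R q p → p ≢ q →
  position (f p) (map f zs) < position (f q) (map f zs)
position-mono f (R ∷ Rs) (u ∷ us) (here refl) (here refl) ¬Rqp p≢q = contradiction refl p≢q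
position-mono f {zs = z ∷ zs} (R ∷ Rs) (u ∷ us) (here refl) (there q∈)  ¬Rqp p≢q =
  subst₂ _<_ (sym (position-here (f z) (map f zs))) (sym (position-there _ (All.lookup u (∈-map⁺ f q∈)))) z<s
position-mono f (R ∷ Rs) (u ∷ us) (there p∈)  (here refl) ¬Rqp p≢q = contradiction (All.lookup R p∈) ¬Rqp
position-mono f (R ∷ Rs) (u ∷ us) (there p∈)  (there q∈)  ¬Rqp p≢q =
  subst₂ _<_ (sym (position-there _ (All.lookup u (∈-map⁺ f p∈))))
             (sym (position-there _ (All.lookup u (∈-map⁺ f q∈))))
    (s≤s (position-mono f Rs us p∈ q∈ ¬Rqp p≢q))

range : ℕ → ℕ → List ℕ
range x zero    = []
range x (suc m) = x ∷ range (suc x) m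

≤-range : ∀ x m → All (x ≤_) (range x m)
≤-range x zero    = []
≤-range x (suc m) = ℕ.≤-refl ∷ All.map ℕ.<⇒≤ (≤-range (suc x) m)

range-unique : ∀ x m → Unique (range x m)
range-unique x zero    = []
range-unique x (suc m) = All.map ℕ.<⇒≢ (≤-range (suc x) m) ∷ range-unique (suc x) m

coloured : ℕ → List (Cell n) → List (Cell n)
coloured i = filter (λ p → colour (proj₁ p) ℕ.≟ i)

coloured-rowCells : ∀ x c i (row : List (Fin n)) →
  map (letter ∘ proj₁) (coloured (c + i) (rowCells x c row)) ≡ map (λ _ → x) (heads (drop i row ∷ []))
coloured-rowCells x c zero    [] = refl
coloured-rowCells x c (suc i) [] = refl
coloured-rowCells x c zero (e ∷ row) = trans
  (cong (map (letter ∘ proj₁)) (List.filter-accept (λ p → colour (proj₁ p) ℕ.≟ c + 0)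
    {xs = rowCells x (suc c) row} (sym (ℕ.+-identityʳ c))))
  (cong (λ ps → x ∷ map (letter ∘ proj₁) ps) (List.filter-none (λ p → colour (proj₁ p) ℕ.≟ c + 0)
    (All.tabulate λ p∈ k≡ → ℕ.<-irrefl (trans (sym (ℕ.+-identityʳ c)) (sym k≡))
      (proj₂ (rowCells-bounds (suc c) row p∈)))))
coloured-rowCells x c (suc i) (e ∷ row) = trans
  (cong (map (letter ∘ proj₁)) (List.filter-reject (λ p → colour (proj₁ p) ℕ.≟ c + suc i)
    λ c≡ → ℕ.<-irrefl c≡ (ℕ.m<m+n c z<s)))
  (trans (cong (λ k → map (letter ∘ proj₁) (coloured k (rowCells x (suc c) row))) (ℕ.+-suc c i))
    (coloured-rowCells x (suc c) i row))

-- No letter is skipped: where column `i` first meets an exhausted row, decreasing lengths leave no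
-- cell of colour `suc i` further on.
coloured-cells : ∀ x i (rows : List (List (Fin n))) → Decreasing rows →
  map (letter ∘ proj₁) (coloured (suc i) (cells x rows)) ≡ range x (length (heads (map (drop i) rows)))
coloured-cells x i []           d = refl
coloured-cells x i (row ∷ rows) d = begin
  map (letter ∘ proj₁) (coloured (suc i) (rowCells x 1 row ++ cells (suc x) rows))
    ≡⟨ cong (map (letter ∘ proj₁)) (List.filter-++ _ (rowCells x 1 row) _) ⟩
  map (letter ∘ proj₁) (coloured (suc i) (rowCells x 1 row) ++ coloured (suc i) (cells (suc x) rows))
    ≡⟨ List.map-++ (letter ∘ proj₁) (coloured (suc i) (rowCells x 1 row)) _ ⟩
  map (letter ∘ proj₁) (coloured (suc i) (rowCells x 1 row)) ++
    map (letter ∘ proj₁) (coloured (suc i) (cells (suc x) rows))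
    ≡⟨ cong (_++ _) (coloured-rowCells x 1 i row) ⟩
  map (λ _ → x) (heads (drop i row ∷ [])) ++ map (letter ∘ proj₁) (coloured (suc i) (cells (suc x) rows))
    ≡⟨ rest ⟩
  range x (length (heads (map (drop i) (row ∷ rows)))) ∎
  where
  open ≡-Reasoning
  rest : map (λ _ → x) (heads (drop i row ∷ [])) ++ map (letter ∘ proj₁) (coloured (suc i) (cells (suc x) rows))
    ≡ range x (length (heads (map (drop i) (row ∷ rows))))
  rest with drop i row in eq
  ... | []     = cong (map (letter ∘ proj₁)) (List.filter-none (λ p → colour (proj₁ p) ℕ.≟ suc i)
    (All.tabulate λ p∈ k≡ → no-cells {i = i} (exhausted i {row} d eq) p∈ (ℕ.≤-reflexive (sym k≡))))
  ... | v ∷ vs = cong (x ∷_) (coloured-cells (suc x) i rows (AllPairs.tail d))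

heads-cell : ∀ {x} i (rows : List (List (Fin n))) {v vs} → heads (map (drop i) rows) ≡ v ∷ vs →
  ((x , suc i) , v) ∈ cells x rows
heads-cell i (row ∷ rows) eq with drop i row in eq′
heads-cell i (row ∷ rows) refl | v ∷ vs = ∈-++⁺ˡ (head-rowCells 1 i row eq′)

module _ (R : List (List (Fin n))) (unique : Unique (map proj₁ (cells 1 R))) (d : Decreasing R) (i : ℕ) where

  private
    entries : List (Cell n)
    entries = coloured (suc i) (circleCells (cells 1 R))

    word′ : List ℕ
    word′ = map (letter ∘ proj₁) entries

    word≡ : lettersOfColour (suc i) (place (cells 1 R)) ≡ word′
    word≡ = begin
      map letter (filter _ (circle (place (cells 1 R))))
        ≡⟨ cong (map letter ∘ filter _) (map-proj₁-circleCells (cells 1 R)) ⟨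
      map letter (filter _ (map proj₁ (circleCells (cells 1 R))))
        ≡⟨ cong (map letter) (filter-map _ proj₁ (circleCells (cells 1 R))) ⟩
      map letter (map proj₁ entries) ≡⟨ List.map-∘ entries ⟨
      word′ ∎
      where open ≡-Reasoning

    word-↭ : word′ ↭ range 1 (length (heads (map (drop i) R)))
    word-↭ = ↭-trans (map⁺ (letter ∘ proj₁) (filter-↭ _ (circleCells-↭ (cells 1 R))))
      (↭-reflexive (coloured-cells 1 i R d))

    ∈-entries : ∀ {x e} → ((x , suc i) , e) ∈ cells 1 R → ((x , suc i) , e) ∈ entries
    ∈-entries p∈ = ∈-filter⁺ _ (∈-resp-↭ (↭-sym (circleCells-↭ (cells 1 R))) p∈) refl

    position-< : ∀ {p q} → p ∈ entries → q ∈ entries → ¬ Precedes q p → p ≢ q →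
      position (letter (proj₁ p)) word′ < position (letter (proj₁ q)) word′
    position-< = position-mono (letter ∘ proj₁)
      (AllPairs.filter⁺ _ (circleCells-sorted (cells 1 R) unique))
      (Unique-resp-↭ (↭-sym word-↭) (range-unique 1 _))

    -- The circle lists lower rows first, and in a common row the larger letter `suc x` comes before
    -- `x`, so equality of rows is not an ascent.
    ascent : ∀ {x v w} → ((x , suc i) , v) ∈ cells 1 R → ((suc x , suc i) , w) ∈ cells 1 R →
      does (position x word′ ℕ.<? position (suc x) word′) ≡ does (v Fin.<? w)
    ascent {x} {v} {w} v∈ w∈ =
      does-⇔ (mk⇔ to from) (position x word′ ℕ.<? position (suc x) word′) (v Fin.<? w)
      where
      from : v Fin.< w → position x word′ < position (suc x) word′
      from v<w = position-< (∈-entries v∈) (∈-entries w∈)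
        (λ { (inj₁ w<v) → ℕ.<-asym v<w w<v ; (inj₂ (refl , _)) → ℕ.<-irrefl refl v<w }) λ ()
      to : position x word′ < position (suc x) word′ → v Fin.< w
      to lt with v Fin.<? w
      ... | yes v<w = v<w
      ... | no v≮w  = contradiction lt (ℕ.<⇒≯ (position-< (∈-entries w∈) (∈-entries v∈)
        (λ { (inj₁ v<w) → v≮w v<w
           ; (inj₂ (_ , inj₁ 1+x<x)) → ℕ.<-asym 1+x<x (ℕ.n<1+n x)
           ; (inj₂ (_ , inj₂ (eq , _))) → ℕ.1+n≢n eq }) λ ()))

    label-step : ∀ l m M (b : Bool) →
      l + (m * (if b then suc l else l) + M) ≡ suc m * l + ((if b then m else 0) + M)
    label-step l m M true  = lemma l m M
      where
      lemma : ∀ l m M → l + (m * suc l + M) ≡ suc m * l + (m + M)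
      lemma = solve-∀
    label-step l m M false = sym (ℕ.+-assoc l (m * l) M)

    -- Every letter inherits the label of the first one, hence the product; what it gains beyond
    -- that comes from ascents. Leaving the first label arbitrary makes the statement inductive
    -- along the column.
    sum-labels : ∀ x rows → (∀ {p} → p ∈ cells (suc x) rows → p ∈ cells 1 R) →
      let ws = heads (map (drop i) rows) in
      sum (map (label word′) (range (suc x) (length ws))) ≡ length ws * label word′ (suc x) + maj ws
    sum-labels x []           sub = refl
    sum-labels x (row ∷ rows) sub with drop i row in eq
    ... | []     = refl
    ... | v ∷ vs
      with heads (map (drop i) rows) in eq′
         | sum-labels (suc x) rows (sub ∘ ∈-++⁺ʳ (rowCells (suc x) 1 row))
    ... | []     | _  = sym (ℕ.+-identityʳ _)
    ... | w ∷ ws | ih = begin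
      label word′ (suc x) + sum (map (label word′) (range (suc (suc x)) (length (w ∷ ws))))
        ≡⟨ cong (label word′ (suc x) +_) ih ⟩
      label word′ (suc x) + (length (w ∷ ws) * label word′ (suc (suc x)) + maj (w ∷ ws))
        ≡⟨ cong (λ b → label word′ (suc x) +
             (length (w ∷ ws) * (if b then suc (label word′ (suc x)) else label word′ (suc x)) + maj (w ∷ ws)))
             (ascent (sub (∈-++⁺ˡ (head-rowCells 1 i row eq)))
                     (sub (∈-++⁺ʳ (rowCells (suc x) 1 row) (heads-cell i rows eq′)))) ⟩
      label word′ (suc x) +
        (length (w ∷ ws) * (if does (v Fin.<? w) then suc (label word′ (suc x)) else label word′ (suc x))
          + maj (w ∷ ws))
        ≡⟨ label-step (label word′ (suc x)) (length (w ∷ ws)) (maj (w ∷ ws)) (does (v Fin.<? w)) ⟩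
      suc (length (w ∷ ws)) * label word′ (suc x) + maj (v ∷ w ∷ ws) ∎
      where open ≡-Reasoning

  colourCocharge≡maj : let w = lettersOfColour (suc i) (place (cells 1 R)) in
    sum (map (label w) w) ≡ maj (heads (map (drop i) R))
  colourCocharge≡maj rewrite word≡ = begin
    -- A label depends on the letter and the fixed circle word, so the sum may be taken in
    -- increasing order of letters.
    sum (map (label word′) word′) ≡⟨ sum-↭ (map⁺ (label word′) word-↭) ⟩
    sum (map (label word′) (range 1 (length (heads (map (drop i) R))))) ≡⟨ sum-labels 0 R id ⟩
    -- The letter 1 has label 0, so only the contribution of the ascents is left.
    length (heads (map (drop i) R)) * 0 + maj (heads (map (drop i) R))
      ≡⟨ cong (_+ maj (heads (map (drop i) R))) (ℕ.*-zeroʳ (length (heads (map (drop i) R)))) ⟩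
    maj (heads (map (drop i) R)) ∎
    where open ≡-Reasoning

-- Back to fillings of the shape

fromRowLists : ∀ {ks} (G : Filling n ks) {R} → Pointwise _↭_ R (rowLists G) →
  ∃[ F ] rowLists {ks = ks} F ≡ R
fromRowLists []        []                 = [] , refl
fromRowLists (row ∷ G) (_∷_ {x = es} p ps)
  with F , refl ← fromRowLists G ps
  with refl ← trans (Perm.↭-length p) (Vec.length-toList row)
  = Vec.fromList es ∷ F , cong (_∷ rowLists F) (Vec.toList∘fromList es)

rowLists-injective : ∀ {ks} (F G : Filling n ks) → rowLists F ≡ rowLists G → F ≡ G
rowLists-injective []      []      eq = refl
rowLists-injective (r ∷ F) (s ∷ G) eq = cong₂ _∷_
  (trans (sym (Vec.cast-is-id refl r)) (Vec.toList-injective refl r s (List.∷-injectiveˡ eq)))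
  (rowLists-injective F G (List.∷-injectiveʳ eq))

module _ (μ : Partition) where

  parts-decreasing : AllPairs (λ k l → l ≤ k) (parts μ)
  parts-decreasing = Linked.Linked⇒AllPairs (flip ℕ.≤-trans) (decreasing μ)

  parts-bounded : All (_≤ largest μ) (parts μ)
  parts-bounded = bounded parts-decreasing
    where
    bounded : ∀ {ks} → AllPairs (λ k l → l ≤ k) ks → All (_≤ foldr (λ k _ → k) 0 ks) ks
    bounded []       = []
    bounded (ls ∷ _) = ℕ.≤-refl ∷ ls

module _ {μ : Partition} (F : Filling n (parts μ)) where

  rowLists-decreasing : Decreasing (rowLists F)
  rowLists-decreasing = AllPairs.map⁻ (subst (AllPairs _) (sym (rowLists-length F)) (parts-decreasing μ))

  rowLists-bounded : All (λ row → length row ≤ largest μ) (rowLists F)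
  rowLists-bounded = All.map⁻ (subst (All _) (sym (rowLists-length F)) (parts-bounded μ))

  companion≡ : companion F ≡ place (cells 1 (rowLists F))
  companion≡ = cong place (cellsFrom≡cells 1 F)

  cells-unique : Unique (map proj₁ (cells 1 (rowLists F)))
  cells-unique = subst Unique
    (trans (sym (map-proj₁-cellsFrom 1 F)) (cong (map proj₁) (cellsFrom≡cells 1 F)))
    (colouredLettersFrom-unique 1 (parts μ))

  companion-faithful⇒ : IsFaithful (companion F) → Faithful (rowLists F)
  companion-faithful⇒ = IsFaithful⇒Faithful (rowLists F) cells-unique ∘ subst IsFaithful companion≡

  companion-faithful⇐ : Faithful (rowLists F) → IsFaithful (companion F)
  companion-faithful⇐ = subst IsFaithful (sym companion≡) ∘
    Faithful⇒IsFaithful (rowLists F) cells-unique rowLists-decreasing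

  cocharge-companion : cocharge μ (companion F) ≡
    sum (map maj (List.applyUpTo (λ i → heads (map (drop i) (rowLists F))) (largest μ)))
  cocharge-companion rewrite companion≡ = cong sum (trans
    (List.map-cong (colourCocharge≡maj (rowLists F) cells-unique rowLists-decreasing) (List.upTo (largest μ)))
    (trans (List.map-upTo _ (largest μ)) (sym (List.map-applyUpTo _ maj (largest μ)))))

proposition42 : (μ : Partition) (b : B⊗ μ) →
    Σ (∃! _≡_ (IsFaithfulRecolouring μ (companion (tabloid b)))) λ T₀ →
    zmaj μ b ≡ cocharge μ (proj₁ T₀)
proposition42 μ b = (companion F , recolouring , unique) , zmaj≡cocharge
  where
  G = tabloid b

  table : ∃[ R ] Pointwise _↭_ R (rowLists G) × Faithful R
  table = faithful-exists (largest μ) (rowLists G) (rowLists-bounded {μ = μ} G)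

  filling : ∃[ F ] rowLists {ks = parts μ} F ≡ proj₁ table
  filling = fromRowLists G (proj₁ (proj₂ table))

  F : Filling (size μ) (parts μ)
  F = proj₁ filling

  F↭G : Pointwise _↭_ (rowLists F) (rowLists G)
  F↭G = subst (λ R → Pointwise _↭_ R (rowLists G)) (sym (proj₂ filling)) (proj₁ (proj₂ table))

  F-faithful : Faithful (rowLists F)
  F-faithful = subst Faithful (sym (proj₂ filling)) (proj₂ (proj₂ table))

  recolouring : IsFaithfulRecolouring μ (companion G) (companion F)
  recolouring = record
    { isColouredTabloid = companion-isColouredTabloid μ F
    ; faithful          = companion-faithful⇐ {μ = μ} F F-faithful
    ; sameLetters       = ↭⇒companion-letters F G F↭G
    }

  unique : ∀ {T} → IsFaithfulRecolouring μ (companion G) T → companion F ≡ T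
  -- A competing recolouring is the companion of some `H`, which is faithful and has the rows of `F`
  -- up to permutation.
  unique r with H , refl ← colouredTabloid⇒companion (IsFaithfulRecolouring.isColouredTabloid r) =
    cong companion (rowLists-injective F H (faithful-unique (largest μ) F-faithful
      (companion-faithful⇒ {μ = μ} H (IsFaithfulRecolouring.faithful r))
      (rowLists-decreasing {μ = μ} F)
      (companion-letters⇒↭ F H (trans (↭⇒companion-letters F G F↭G)
        (sym (IsFaithfulRecolouring.sameLetters r))))
      (rowLists-bounded {μ = μ} F)))

  zmaj≡cocharge : zmaj μ b ≡ cocharge μ (companion F)
  zmaj≡cocharge = trans
    (cong (sum ∘ map maj) (selections≡ (largest μ) F-faithful (rowLists-decreasing {μ = μ} F) F↭G))
    (sym (cocharge-companion {μ = μ} F))
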